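{- Let $p$ be an odd prime number and let $s\geq 1$ be an integer. Then the domination number of the undirected zero divisor graph $\overline{\Gamma}(\mathbb{Z}_{p^{s}}[i,j,k])$ is $p+1$.
   Context: For a positive integer $n$, $\mathbb{Z}_n$ is the ring of integers modulo $n$, and $\mathbb{Z}_{n}[i,j,k]=\{a+bi+cj+dk\mid a,b,c,d\in\mathbb{Z}_n\}$ is the ring of Lipschitz quaternions modulo $n$, with the usual quaternion multiplication ($i^2=j^2=k^2=ijk=-1$). For a ring $R$ with identity, $Z^{*}(R)$ is the set of non-zero zero divisors of $R$ (elements that are left or right zero divisors). The undirected zero divisor graph $\overline{\Gamma}(R)$ has vertex set $Z^{*}(R)$, and distinct vertices $a$ and $b$ are adjacent if and only if $ab=0$ or $ba=0$. A dominating set of a graph $G$ is a subset $S$ of the vertices such that every vertex not in $S$ is adjacent to at least one vertex of $S$; the domination number of $G$ is the minimum number of vertices in a dominating set. -}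

module Defs where

open import Algebra.Bundles using (Ring; CommutativeRing)
open import Data.Integer as ℤ using (ℤ; +_; 0ℤ; 1ℤ)
open import Data.Integer.Divisibility.Signed
  using (_∣_; divides; ∣m∣n⇒∣m+n; ∣m⇒∣-m; ∣n⇒∣m*n; ∣m⇒∣m*n)
import Data.Integer.Properties as ℤ
open import Data.Integer.Tactic.RingSolver using (solve-∀)
open import Data.List using (List; length)
import Data.List.Membership.Setoid as Membership
import Data.List.Relation.Unary.Unique.Setoid as Uniqueness
open import Data.Nat using (ℕ; _≤_)
open import Data.Product using (Σ-syntax; ∃-syntax; _×_; _,_; proj₁)
open import Data.Sum as Sum using (_⊎_; swap)
open import Level using (_⊔_; suc; 0ℓ)
open import Relation.Binary
  using (Rel; Setoid; IsEquivalence; Symmetric; Irreflexive; _Respects₂_)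
import Relation.Binary.Construct.On as On
open import Relation.Binary.PropositionalEquality
  using (_≡_; refl; subst)

-- ℤ/nℤ is the setoid of integers under congruence.  Congruence is a
-- record, rather than a synonym for divisibility, so that its two sides
-- can be inferred.  For n = 0 it is equality of integers.

infix 4 _≡_[mod_]

record _≡_[mod_] (a b : ℤ) (n : ℕ) : Set where
  constructor congruent
  field n∣a-b : + n ∣ a ℤ.- b

open _≡_[mod_] public

module _ {n : ℕ} where

  ≡⇒≡[mod] : ∀ {a b} → a ≡ b → a ≡ b [mod n ]
  ≡⇒≡[mod] {a} refl = congruent (divides 0ℤ (ℤ.+-inverseʳ a))

  ≡[mod]-isEquivalence : IsEquivalence (_≡_[mod n ])
  ≡[mod]-isEquivalence = record
    { refl  = ≡⇒≡[mod] refl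
    ; sym   = λ {a} {b} p → congruent
        (subst (+ n ∣_) (negate a b) (∣m⇒∣-m (n∣a-b p)))
    ; trans = λ {a} {b} {c} p q → congruent
        (subst (+ n ∣_) (telescope a b c) (∣m∣n⇒∣m+n (n∣a-b p) (n∣a-b q)))
    }
    where
    negate : ∀ a b → ℤ.- (a ℤ.- b) ≡ b ℤ.- a
    negate = solve-∀
    telescope : ∀ a b c → (a ℤ.- b) ℤ.+ (b ℤ.- c) ≡ a ℤ.- c
    telescope = solve-∀

  +-cong-mod : ∀ {a b c d} → a ≡ b [mod n ] → c ≡ d [mod n ] →
               a ℤ.+ c ≡ b ℤ.+ d [mod n ]
  +-cong-mod {a} {b} {c} {d} p q = congruent
    (subst (+ n ∣_) (eq a b c d) (∣m∣n⇒∣m+n (n∣a-b p) (n∣a-b q)))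
    where
    eq : ∀ a b c d → (a ℤ.- b) ℤ.+ (c ℤ.- d) ≡ (a ℤ.+ c) ℤ.- (b ℤ.+ d)
    eq = solve-∀

  -‿cong-mod : ∀ {a b} → a ≡ b [mod n ] → ℤ.- a ≡ ℤ.- b [mod n ]
  -‿cong-mod {a} {b} p = congruent
    (subst (+ n ∣_) (eq a b) (∣m⇒∣-m (n∣a-b p)))
    where
    eq : ∀ a b → ℤ.- (a ℤ.- b) ≡ (ℤ.- a) ℤ.- (ℤ.- b)
    eq = solve-∀

  *-cong-mod : ∀ {a b c d} → a ≡ b [mod n ] → c ≡ d [mod n ] →
               a ℤ.* c ≡ b ℤ.* d [mod n ]
  *-cong-mod {a} {b} {c} {d} p q = congruent
    (subst (+ n ∣_) (eq a b c d)
      (∣m∣n⇒∣m+n (∣m⇒∣m*n c (n∣a-b p)) (∣n⇒∣m*n b (n∣a-b q))))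
    where
    eq : ∀ a b c d →
         (a ℤ.- b) ℤ.* c ℤ.+ b ℤ.* (c ℤ.- d) ≡ (a ℤ.* c) ℤ.- (b ℤ.* d)
    eq = solve-∀

ℤ/_ : ℕ → CommutativeRing 0ℓ 0ℓ
ℤ/ n = record
  { Carrier = ℤ
  ; _≈_     = _≡_[mod n ]
  ; _+_     = ℤ._+_
  ; _*_     = ℤ._*_
  ; -_      = ℤ.-_
  ; 0#      = 0ℤ
  ; 1#      = 1ℤ
  ; isCommutativeRing = record
    { isRing = record
      { +-isAbelianGroup = record
        { isGroup = record
          { isMonoid = record
            { isSemigroup = record
              { isMagma = record
                { isEquivalence = ≡[mod]-isEquivalence
                ; ∙-cong        = +-cong-mod
                }
              ; assoc = λ a b c → ≡⇒≡[mod] (ℤ.+-assoc a b c)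
              }
            ; identity = (λ a → ≡⇒≡[mod] (ℤ.+-identityˡ a))
                       , (λ a → ≡⇒≡[mod] (ℤ.+-identityʳ a))
            }
          ; inverse = (λ a → ≡⇒≡[mod] (ℤ.+-inverseˡ a))
                    , (λ a → ≡⇒≡[mod] (ℤ.+-inverseʳ a))
          ; ⁻¹-cong = -‿cong-mod
          }
        ; comm = λ a b → ≡⇒≡[mod] (ℤ.+-comm a b)
        }
      ; *-cong     = *-cong-mod
      ; *-assoc    = λ a b c → ≡⇒≡[mod] (ℤ.*-assoc a b c)
      ; *-identity = (λ a → ≡⇒≡[mod] (ℤ.*-identityˡ a))
                   , (λ a → ≡⇒≡[mod] (ℤ.*-identityʳ a))
      ; distrib    = (λ a b c → ≡⇒≡[mod] (ℤ.*-distribˡ-+ a b c))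
                   , (λ a b c → ≡⇒≡[mod] (ℤ.*-distribʳ-+ a b c))
      }
    ; *-comm = λ a b → ≡⇒≡[mod] (ℤ.*-comm a b)
    }
  }

-- quaternion a b c d  is  a + b i + c j + d k.  The coefficients are
-- integers representing residue classes; ℤ/ n [i,j,k] below compares them
-- in ℤ/ n.

record Quaternion : Set where
  constructor quaternion
  field re imᵢ imⱼ imₖ : ℤ

open Quaternion public

infixl 6 _+ᴴ_
infixl 7 _*ᴴ_
infix  8 -ᴴ_

_+ᴴ_ : Quaternion → Quaternion → Quaternion
quaternion a b c d +ᴴ quaternion a′ b′ c′ d′ =
  quaternion (a ℤ.+ a′) (b ℤ.+ b′) (c ℤ.+ c′) (d ℤ.+ d′)

-ᴴ_ : Quaternion → Quaternion
-ᴴ quaternion a b c d = quaternion (ℤ.- a) (ℤ.- b) (ℤ.- c) (ℤ.- d)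

_*ᴴ_ : Quaternion → Quaternion → Quaternion
quaternion a b c d *ᴴ quaternion a′ b′ c′ d′ = quaternion
  (a ℤ.* a′ ℤ.- b ℤ.* b′ ℤ.- c ℤ.* c′ ℤ.- d ℤ.* d′)
  (a ℤ.* b′ ℤ.+ b ℤ.* a′ ℤ.+ c ℤ.* d′ ℤ.- d ℤ.* c′)
  (a ℤ.* c′ ℤ.- b ℤ.* d′ ℤ.+ c ℤ.* a′ ℤ.+ d ℤ.* b′)
  (a ℤ.* d′ ℤ.+ b ℤ.* c′ ℤ.- c ℤ.* b′ ℤ.+ d ℤ.* a′)

0ᴴ 1ᴴ iᴴ jᴴ kᴴ : Quaternion
0ᴴ = quaternion 0ℤ 0ℤ 0ℤ 0ℤ
1ᴴ = quaternion 1ℤ 0ℤ 0ℤ 0ℤ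
iᴴ = quaternion 0ℤ 1ℤ 0ℤ 0ℤ
jᴴ = quaternion 0ℤ 0ℤ 1ℤ 0ℤ
kᴴ = quaternion 0ℤ 0ℤ 0ℤ 1ℤ

i² : iᴴ *ᴴ iᴴ ≡ -ᴴ 1ᴴ
i² = refl

j² : jᴴ *ᴴ jᴴ ≡ -ᴴ 1ᴴ
j² = refl

k² : kᴴ *ᴴ kᴴ ≡ -ᴴ 1ᴴ
k² = refl

ijk : iᴴ *ᴴ jᴴ *ᴴ kᴴ ≡ -ᴴ 1ᴴ
ijk = refl

infix 4 _≈ᴴ_[mod_]

record _≈ᴴ_[mod_] (x y : Quaternion) (n : ℕ) : Set where
  constructor components
  open CommutativeRing (ℤ/ n) using (_≈_)
  field
    re≈  : re  x ≈ re  y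
    imᵢ≈ : imᵢ x ≈ imᵢ y
    imⱼ≈ : imⱼ x ≈ imⱼ y
    imₖ≈ : imₖ x ≈ imₖ y

private
  infix 4 _≗ᴴ_
  record _≗ᴴ_ (x y : Quaternion) : Set where
    constructor exactly
    field
      re≡  : re  x ≡ re  y
      imᵢ≡ : imᵢ x ≡ imᵢ y
      imⱼ≡ : imⱼ x ≡ imⱼ y
      imₖ≡ : imₖ x ≡ imₖ y

  mod : ∀ {n x y} → x ≗ᴴ y → x ≈ᴴ y [mod n ]
  mod (exactly p q r s) =
    components (≡⇒≡[mod] p) (≡⇒≡[mod] q) (≡⇒≡[mod] r) (≡⇒≡[mod] s)

  *ᴴ-assoc : ∀ x y z → (x *ᴴ y) *ᴴ z ≗ᴴ x *ᴴ (y *ᴴ z)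
  *ᴴ-assoc (quaternion a b c d) (quaternion a′ b′ c′ d′) (quaternion a″ b″ c″ d″) =
    exactly (e₁ a b c d a′ b′ c′ d′ a″ b″ c″ d″) (e₂ a b c d a′ b′ c′ d′ a″ b″ c″ d″)
            (e₃ a b c d a′ b′ c′ d′ a″ b″ c″ d″) (e₄ a b c d a′ b′ c′ d′ a″ b″ c″ d″)
    where
    open import Data.Integer using (_+_; _*_; _-_)
    e₁ : ∀ a b c d a′ b′ c′ d′ a″ b″ c″ d″ →
         (a * a′ - b * b′ - c * c′ - d * d′) * a″ - (a * b′ + b * a′ + c * d′ - d * c′) * b″ - (a * c′ - b * d′ + c * a′ + d * b′) * c″ - (a * d′ + b * c′ - c * b′ + d * a′) * d″
         ≡ a * (a′ * a″ - b′ * b″ - c′ * c″ - d′ * d″) - b * (a′ * b″ + b′ * a″ + c′ * d″ - d′ * c″) - c * (a′ * c″ - b′ * d″ + c′ * a″ + d′ * b″) - d * (a′ * d″ + b′ * c″ - c′ * b″ + d′ * a″)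
    e₁ = solve-∀
    e₂ : ∀ a b c d a′ b′ c′ d′ a″ b″ c″ d″ →
         (a * a′ - b * b′ - c * c′ - d * d′) * b″ + (a * b′ + b * a′ + c * d′ - d * c′) * a″ + (a * c′ - b * d′ + c * a′ + d * b′) * d″ - (a * d′ + b * c′ - c * b′ + d * a′) * c″
         ≡ a * (a′ * b″ + b′ * a″ + c′ * d″ - d′ * c″) + b * (a′ * a″ - b′ * b″ - c′ * c″ - d′ * d″) + c * (a′ * d″ + b′ * c″ - c′ * b″ + d′ * a″) - d * (a′ * c″ - b′ * d″ + c′ * a″ + d′ * b″)
    e₂ = solve-∀
    e₃ : ∀ a b c d a′ b′ c′ d′ a″ b″ c″ d″ →
         (a * a′ - b * b′ - c * c′ - d * d′) * c″ - (a * b′ + b * a′ + c * d′ - d * c′) * d″ + (a * c′ - b * d′ + c * a′ + d * b′) * a″ + (a * d′ + b * c′ - c * b′ + d * a′) * b″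
         ≡ a * (a′ * c″ - b′ * d″ + c′ * a″ + d′ * b″) - b * (a′ * d″ + b′ * c″ - c′ * b″ + d′ * a″) + c * (a′ * a″ - b′ * b″ - c′ * c″ - d′ * d″) + d * (a′ * b″ + b′ * a″ + c′ * d″ - d′ * c″)
    e₃ = solve-∀
    e₄ : ∀ a b c d a′ b′ c′ d′ a″ b″ c″ d″ →
         (a * a′ - b * b′ - c * c′ - d * d′) * d″ + (a * b′ + b * a′ + c * d′ - d * c′) * c″ - (a * c′ - b * d′ + c * a′ + d * b′) * b″ + (a * d′ + b * c′ - c * b′ + d * a′) * a″
         ≡ a * (a′ * d″ + b′ * c″ - c′ * b″ + d′ * a″) + b * (a′ * c″ - b′ * d″ + c′ * a″ + d′ * b″) - c * (a′ * b″ + b′ * a″ + c′ * d″ - d′ * c″) + d * (a′ * a″ - b′ * b″ - c′ * c″ - d′ * d″)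
    e₄ = solve-∀

  *ᴴ-identityˡ : ∀ x → 1ᴴ *ᴴ x ≗ᴴ x
  *ᴴ-identityˡ (quaternion a b c d) =
    exactly (e₁ a b c d) (e₂ a b c d) (e₃ a b c d) (e₄ a b c d)
    where
    open import Data.Integer using (_+_; _*_; _-_)
    e₁ : ∀ a b c d →
         1ℤ * a - 0ℤ * b - 0ℤ * c - 0ℤ * d
         ≡ a
    e₁ = solve-∀
    e₂ : ∀ a b c d →
         1ℤ * b + 0ℤ * a + 0ℤ * d - 0ℤ * c
         ≡ b
    e₂ = solve-∀
    e₃ : ∀ a b c d →
         1ℤ * c - 0ℤ * d + 0ℤ * a + 0ℤ * b
         ≡ c
    e₃ = solve-∀
    e₄ : ∀ a b c d →
         1ℤ * d + 0ℤ * c - 0ℤ * b + 0ℤ * a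
         ≡ d
    e₄ = solve-∀

  *ᴴ-identityʳ : ∀ x → x *ᴴ 1ᴴ ≗ᴴ x
  *ᴴ-identityʳ (quaternion a b c d) =
    exactly (e₁ a b c d) (e₂ a b c d) (e₃ a b c d) (e₄ a b c d)
    where
    open import Data.Integer using (_+_; _*_; _-_)
    e₁ : ∀ a b c d →
         a * 1ℤ - b * 0ℤ - c * 0ℤ - d * 0ℤ
         ≡ a
    e₁ = solve-∀
    e₂ : ∀ a b c d →
         a * 0ℤ + b * 1ℤ + c * 0ℤ - d * 0ℤ
         ≡ b
    e₂ = solve-∀
    e₃ : ∀ a b c d →
         a * 0ℤ - b * 0ℤ + c * 1ℤ + d * 0ℤ
         ≡ c
    e₃ = solve-∀
    e₄ : ∀ a b c d →
         a * 0ℤ + b * 0ℤ - c * 0ℤ + d * 1ℤ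
         ≡ d
    e₄ = solve-∀

  *ᴴ-distribˡ-+ᴴ : ∀ x y z → x *ᴴ (y +ᴴ z) ≗ᴴ x *ᴴ y +ᴴ x *ᴴ z
  *ᴴ-distribˡ-+ᴴ (quaternion a b c d) (quaternion a′ b′ c′ d′) (quaternion a″ b″ c″ d″) =
    exactly (e₁ a b c d a′ b′ c′ d′ a″ b″ c″ d″) (e₂ a b c d a′ b′ c′ d′ a″ b″ c″ d″) (e₃ a b c d a′ b′ c′ d′ a″ b″ c″ d″) (e₄ a b c d a′ b′ c′ d′ a″ b″ c″ d″)
    where
    open import Data.Integer using (_+_; _*_; _-_)
    e₁ : ∀ a b c d a′ b′ c′ d′ a″ b″ c″ d″ →
         a * (a′ + a″) - b * (b′ + b″) - c * (c′ + c″) - d * (d′ + d″)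
         ≡ (a * a′ - b * b′ - c * c′ - d * d′) + (a * a″ - b * b″ - c * c″ - d * d″)
    e₁ = solve-∀
    e₂ : ∀ a b c d a′ b′ c′ d′ a″ b″ c″ d″ →
         a * (b′ + b″) + b * (a′ + a″) + c * (d′ + d″) - d * (c′ + c″)
         ≡ (a * b′ + b * a′ + c * d′ - d * c′) + (a * b″ + b * a″ + c * d″ - d * c″)
    e₂ = solve-∀
    e₃ : ∀ a b c d a′ b′ c′ d′ a″ b″ c″ d″ →
         a * (c′ + c″) - b * (d′ + d″) + c * (a′ + a″) + d * (b′ + b″)
         ≡ (a * c′ - b * d′ + c * a′ + d * b′) + (a * c″ - b * d″ + c * a″ + d * b″)
    e₃ = solve-∀
    e₄ : ∀ a b c d a′ b′ c′ d′ a″ b″ c″ d″ →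
         a * (d′ + d″) + b * (c′ + c″) - c * (b′ + b″) + d * (a′ + a″)
         ≡ (a * d′ + b * c′ - c * b′ + d * a′) + (a * d″ + b * c″ - c * b″ + d * a″)
    e₄ = solve-∀

  *ᴴ-distribʳ-+ᴴ : ∀ x y z → (y +ᴴ z) *ᴴ x ≗ᴴ y *ᴴ x +ᴴ z *ᴴ x
  *ᴴ-distribʳ-+ᴴ (quaternion a b c d) (quaternion a′ b′ c′ d′) (quaternion a″ b″ c″ d″) =
    exactly (e₁ a b c d a′ b′ c′ d′ a″ b″ c″ d″) (e₂ a b c d a′ b′ c′ d′ a″ b″ c″ d″) (e₃ a b c d a′ b′ c′ d′ a″ b″ c″ d″) (e₄ a b c d a′ b′ c′ d′ a″ b″ c″ d″)
    where
    open import Data.Integer using (_+_; _*_; _-_)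
    e₁ : ∀ a b c d a′ b′ c′ d′ a″ b″ c″ d″ →
         (a′ + a″) * a - (b′ + b″) * b - (c′ + c″) * c - (d′ + d″) * d
         ≡ (a′ * a - b′ * b - c′ * c - d′ * d) + (a″ * a - b″ * b - c″ * c - d″ * d)
    e₁ = solve-∀
    e₂ : ∀ a b c d a′ b′ c′ d′ a″ b″ c″ d″ →
         (a′ + a″) * b + (b′ + b″) * a + (c′ + c″) * d - (d′ + d″) * c
         ≡ (a′ * b + b′ * a + c′ * d - d′ * c) + (a″ * b + b″ * a + c″ * d - d″ * c)
    e₂ = solve-∀
    e₃ : ∀ a b c d a′ b′ c′ d′ a″ b″ c″ d″ →
         (a′ + a″) * c - (b′ + b″) * d + (c′ + c″) * a + (d′ + d″) * b
         ≡ (a′ * c - b′ * d + c′ * a + d′ * b) + (a″ * c - b″ * d + c″ * a + d″ * b)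
    e₃ = solve-∀
    e₄ : ∀ a b c d a′ b′ c′ d′ a″ b″ c″ d″ →
         (a′ + a″) * d + (b′ + b″) * c - (c′ + c″) * b + (d′ + d″) * a
         ≡ (a′ * d + b′ * c - c′ * b + d′ * a) + (a″ * d + b″ * c - c″ * b + d″ * a)
    e₄ = solve-∀

ℤ/_[i,j,k] : ℕ → Ring 0ℓ 0ℓ
ℤ/ n [i,j,k] = record
  { Carrier = Quaternion
  ; _≈_     = _≈ᴴ_[mod n ]
  ; _+_     = _+ᴴ_
  ; _*_     = _*ᴴ_
  ; -_      = -ᴴ_
  ; 0#      = 0ᴴ
  ; 1#      = 1ᴴ
  ; isRing  = record
    { +-isAbelianGroup = record
      { isGroup = record
        { isMonoid = record
          { isSemigroup = record
            { isMagma = record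
              { isEquivalence = record
                { refl  = components Zn.refl Zn.refl Zn.refl Zn.refl
                ; sym   = λ (components p q r s) →
                    components (Zn.sym p) (Zn.sym q) (Zn.sym r) (Zn.sym s)
                ; trans = λ (components p q r s) (components p′ q′ r′ s′) →
                    components (Zn.trans p p′) (Zn.trans q q′)
                               (Zn.trans r r′) (Zn.trans s s′)
                }
              ; ∙-cong = λ (components p q r s) (components p′ q′ r′ s′) →
                  components (Zn.+-cong p p′) (Zn.+-cong q q′)
                             (Zn.+-cong r r′) (Zn.+-cong s s′)
              }
            ; assoc = λ x y z → components
                (Zn.+-assoc (re x) (re y) (re z)) (Zn.+-assoc (imᵢ x) (imᵢ y) (imᵢ z))
                (Zn.+-assoc (imⱼ x) (imⱼ y) (imⱼ z)) (Zn.+-assoc (imₖ x) (imₖ y) (imₖ z))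
            }
          ; identity =
              (λ x → components (Zn.+-identityˡ (re x)) (Zn.+-identityˡ (imᵢ x))
                                (Zn.+-identityˡ (imⱼ x)) (Zn.+-identityˡ (imₖ x)))
            , (λ x → components (Zn.+-identityʳ (re x)) (Zn.+-identityʳ (imᵢ x))
                                (Zn.+-identityʳ (imⱼ x)) (Zn.+-identityʳ (imₖ x)))
          }
        ; inverse =
            (λ x → components (Zn.-‿inverseˡ (re x)) (Zn.-‿inverseˡ (imᵢ x))
                              (Zn.-‿inverseˡ (imⱼ x)) (Zn.-‿inverseˡ (imₖ x)))
          , (λ x → components (Zn.-‿inverseʳ (re x)) (Zn.-‿inverseʳ (imᵢ x))
                              (Zn.-‿inverseʳ (imⱼ x)) (Zn.-‿inverseʳ (imₖ x)))
        ; ⁻¹-cong = λ (components p q r s) →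
            components (Zn.-‿cong p) (Zn.-‿cong q) (Zn.-‿cong r) (Zn.-‿cong s)
        }
      ; comm = λ x y → components
          (Zn.+-comm (re x) (re y)) (Zn.+-comm (imᵢ x) (imᵢ y))
          (Zn.+-comm (imⱼ x) (imⱼ y)) (Zn.+-comm (imₖ x) (imₖ y))
      }
    ; *-cong = λ (components p q r s) (components p′ q′ r′ s′) → components
        (sub (sub (sub (Zn.*-cong p p′) (Zn.*-cong q q′)) (Zn.*-cong r r′)) (Zn.*-cong s s′))
        (sub (add (add (Zn.*-cong p q′) (Zn.*-cong q p′)) (Zn.*-cong r s′)) (Zn.*-cong s r′))
        (add (add (sub (Zn.*-cong p r′) (Zn.*-cong q s′)) (Zn.*-cong r p′)) (Zn.*-cong s q′))
        (add (sub (add (Zn.*-cong p s′) (Zn.*-cong q r′)) (Zn.*-cong r q′)) (Zn.*-cong s p′))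
    ; *-assoc    = λ x y z → mod (*ᴴ-assoc x y z)
    ; *-identity = (λ x → mod (*ᴴ-identityˡ x)) , (λ x → mod (*ᴴ-identityʳ x))
    ; distrib    = (λ x y z → mod (*ᴴ-distribˡ-+ᴴ x y z))
                 , (λ x y z → mod (*ᴴ-distribʳ-+ᴴ x y z))
    }
  }
  where
  module Zn = CommutativeRing (ℤ/ n)
  add = Zn.+-cong
  sub : ∀ {a b c d} → a Zn.≈ b → c Zn.≈ d → a Zn.- c Zn.≈ b Zn.- d
  sub p q = Zn.+-cong p (Zn.-‿cong q)

record Graph v ℓ e : Set (suc (v ⊔ ℓ ⊔ e)) where
  field
    vertices : Setoid v ℓ
  open Setoid vertices public
    using (_≈_) renaming (Carrier to Vertex)
  field
    _~_      : Rel Vertex e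
    ~-resp-≈ : _~_ Respects₂ _≈_
    ~-sym    : Symmetric _~_
    ~-irrefl : Irreflexive _≈_ _~_

module _ {c ℓ} (R : Ring c ℓ) where

  open Ring R using (Carrier; _≈_; _≉_; _*_; 0#; setoid)
  private module R = Ring R

  IsLeftZeroDivisor : Carrier → Set (c ⊔ ℓ)
  IsLeftZeroDivisor a = ∃[ b ] b ≉ 0# × a * b ≈ 0#

  IsRightZeroDivisor : Carrier → Set (c ⊔ ℓ)
  IsRightZeroDivisor a = ∃[ b ] b ≉ 0# × b * a ≈ 0#

  IsZeroDivisor : Carrier → Set (c ⊔ ℓ)
  IsZeroDivisor a = IsLeftZeroDivisor a ⊎ IsRightZeroDivisor a

  NonzeroZeroDivisor : Set (c ⊔ ℓ)
  NonzeroZeroDivisor = Σ[ a ∈ Carrier ] a ≉ 0# × IsZeroDivisor a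

  -- Vertices are compared as ring elements: the evidence that they are
  -- zero divisors is ignored.

  Γ̄ : Graph (c ⊔ ℓ) ℓ ℓ
  Γ̄ = record
    { vertices = On.setoid {B = NonzeroZeroDivisor} setoid proj₁
    ; _~_      = λ (a , _) (b , _) → a ≉ b × (a * b ≈ 0# ⊎ b * a ≈ 0#)
    ; ~-resp-≈ = (λ b≈b′ (a≉b , ab≈0⊎ba≈0) →
                     (λ a≈b′ → a≉b (R.trans a≈b′ (R.sym b≈b′)))
                   , Sum.map (R.trans (R.*-congˡ (R.sym b≈b′)))
                             (R.trans (R.*-congʳ (R.sym b≈b′))) ab≈0⊎ba≈0)
               , (λ a≈a′ (a≉b , ab≈0⊎ba≈0) →
                     (λ a′≈b → a≉b (R.trans a≈a′ a′≈b))
                   , Sum.map (R.trans (R.*-congʳ (R.sym a≈a′)))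
                             (R.trans (R.*-congˡ (R.sym a≈a′))) ab≈0⊎ba≈0)
    ; ~-sym    = λ (a≉b , ab≈0⊎ba≈0) → (λ b≈a → a≉b (R.sym b≈a)) , swap ab≈0⊎ba≈0
    ; ~-irrefl = λ a≈b (a≉b , _) → a≉b a≈b
    }

module _ {v ℓ e} (G : Graph v ℓ e) where

  open Graph G
  open Membership vertices using (_∈_; _∉_)
  open Uniqueness vertices using (Unique)

  -- A finite set of vertices is a list without repetitions, so that its
  -- length is its cardinality.  Only finite dominating sets are considered,
  -- which loses nothing when the graph has finitely many vertices.

  IsDominatingSet : List Vertex → Set (v ⊔ ℓ ⊔ e)
  IsDominatingSet S = Unique S × (∀ x → x ∉ S → ∃[ y ] y ∈ S × x ~ y)

  IsDominationNumber : ℕ → Set (v ⊔ ℓ ⊔ e)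
  IsDominationNumber k =
      (∃[ S ] IsDominatingSet S × length S ≡ k)
    × (∀ S → IsDominatingSet S → k ≤ length S)

{-# OPTIONS --safe #-}

-- Choose α, β with α² + β² = -1 in ℤ/p.  Then the quaternions over ℤ/p are
-- the 2 × 2 matrices over ℤ/p, and to two lines L, M of (ℤ/p)² belongs an
-- element D L M of rank one, with image L and kernel M.  Modulo p one has
--   D L M · D M N = 0,
--   D L M · D N K = c · D L K  with a unit c, if M ≠ N,
--   D L M - D M L = d · 1      with a unit d, if L ≠ M.
--
-- A zero divisor x modulo pˢ is singular modulo p, so there is a line L with
-- x · D L M = 0 modulo p for every M.  Hence the p + 1 elements pˢ⁻¹ D L M,
-- with M fixed, dominate.
--
-- Conversely let S be a dominating set with at most p elements.  Dividing
-- y ∈ S by the highest possible power of p one finds a line f y, the only L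
-- for which y · D L M can vanish modulo pˢ, and a line g y, the only M for
-- which D L M · y can vanish.  As S is small, f and g miss some lines; let K
-- be missed by g.  For every line L missed by f, neither D L K nor 2 D L K
-- has a neighbour in S, so both belong to S, and f takes the value K at both.
-- Now map a line L ≠ K which f attains to a preimage, a line L missed by f to
-- D L K, and K to 2 D L K for one fixed missed L.  This is an injection of
-- the p + 1 lines into S, a contradiction.

module Submission where

open import Algebra.Bundles using (Ring)
open import Algebra.Properties.Ring using (x[y-z]≈xy-xz; [y-z]x≈yx-zx)
open import Data.Bool using (Bool; true; false; if_then_else_)
open import Data.Fin using (Fin; zero; suc; toℕ; fromℕ<; splitAt; join)
open import Data.Fin.Properties
  using ( _≟_; any?; ¬∀⟶∃¬; injective⇒≤; pigeonhole; <⇒≢; toℕ<n; toℕ-injective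
        ; toℕ-fromℕ<; join-splitAt )
open import Data.Integer as ℤ using (ℤ; +_; -[1+_]; 0ℤ; 1ℤ; ∣_∣)
open import Data.Integer.Divisibility.Signed
open import Data.Integer.DivMod using (_%ℕ_; _/ℕ_; n%ℕd<d; a≡a%ℕn+[a/ℕn]*n)
import Data.Integer.Properties as ℤ
open import Data.Integer.Tactic.RingSolver using (ring; solve-∀)
open import Data.List using (List; length; lookup; tabulate)
import Data.List.Membership.Setoid as Membership
open import Data.List.Membership.Setoid.Properties using (∈-tabulate⁺)
open import Data.List.Properties using (length-tabulate)
import Data.List.Relation.Unary.Any as Any
open import Data.List.Relation.Unary.Any.Properties using (lookup-index)
import Data.List.Relation.Unary.Unique.Setoid.Properties as Unique
open import Data.Nat as ℕ using (ℕ; zero; suc; _^_; _≤_; NonZero; s≤s)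
open import Data.Nat.Coprimality
  using (Coprime; coprime-Bézout; coprime-divisor; 1-coprimeTo)
import Data.Nat.Divisibility as ℕ
open import Data.Nat.Divisibility using (_∤_)
import Data.Nat.DivMod as ℕ
open import Data.Nat.GCD using (module Bézout)
open import Data.Nat.Primality
  using ( Prime; prime⇒nonZero; prime⇒nonTrivial; prime⇒irreducible
        ; irreducible[2]; euclidsLemma )
import Data.Nat.Properties as ℕ
open import Data.Product using (∃-syntax; ∃₂; _×_; _,_; proj₁; proj₂)
open import Data.Sum using (_⊎_; inj₁; inj₂; [_,_]′)
open import Function using (_∘_; case_of_)
open import Relation.Binary using (IsEquivalence)
open import Relation.Binary.PropositionalEquality
  using (_≡_; _≢_; refl; sym; trans; cong; cong₂; subst; subst₂; module ≡-Reasoning)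
import Relation.Binary.Reasoning.Setoid as ≈-Reasoning
open import Relation.Nullary using (¬_; Dec; yes; no; contradiction)
open import Relation.Nullary.Decidable using (map′; _×-dec_; decidable-stable)
open import Tactic.RingSolver.NonReflective ring
  using (Expr; Κ; _⊕_; _⊗_; ⊝_; _⊜_; solve)

open import Defs

-- Quaternions, plane vectors and the matrix picture.

Vector : Set
Vector = ℤ × ℤ

infixr 7 _•_

_•_ : ℤ → Quaternion → Quaternion
c • quaternion a b d e = quaternion (c ℤ.* a) (c ℤ.* b) (c ℤ.* d) (c ℤ.* e)

conj : Quaternion → Quaternion
conj (quaternion a b c d) = quaternion a (ℤ.- b) (ℤ.- c) (ℤ.- d)

norm : Quaternion → ℤ
norm (quaternion a b c d) = a ℤ.* a ℤ.+ b ℤ.* b ℤ.+ c ℤ.* c ℤ.+ d ℤ.* d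

-- `perm` is the permanent of the matrix with rows `u` and `k`. Unlike `det`, the other three forms
-- are symmetric; they carry the imaginary coordinates of `dyad`.
det dot perm diff : Vector → Vector → ℤ
det  (u₁ , u₂) (k₁ , k₂) = u₁ ℤ.* k₂ ℤ.- u₂ ℤ.* k₁
dot  (u₁ , u₂) (k₁ , k₂) = u₁ ℤ.* k₁ ℤ.+ u₂ ℤ.* k₂
perm (u₁ , u₂) (k₁ , k₂) = u₁ ℤ.* k₂ ℤ.+ u₂ ℤ.* k₁
diff (u₁ , u₂) (k₁ , k₂) = u₂ ℤ.* k₂ ℤ.- u₁ ℤ.* k₁

module Matrices (α β : ℤ) where

  open import Data.Integer using (_+_; _*_; _-_; -_)

  -- Modulo α² + β² + 1 the map i ↦ ((0 , -1) , (1 , 0)), j ↦ ((α , β) , (β , -α))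
  -- is a homomorphism to 2 × 2 matrices.  act y u is the image of y applied
  -- to u, and dyad u k corresponds to twice the matrix of v ↦ det k v · u.

  act : Quaternion → Vector → Vector
  act (quaternion a b c d) (u₁ , u₂) =
      (a + (c * α - d * β)) * u₁ + (c * β + d * α - b) * u₂
    , (c * β + d * α + b) * u₁ + (a - (c * α - d * β)) * u₂

  dyad : Vector → Vector → Quaternion
  dyad u k = quaternion
    (det k u)
    (- dot u k)
    (α * perm u k + β * diff u k)
    (α * diff u k - β * perm u k)

-- The same formulas for polynomials, as input to the ring solver.

module Formal {n : ℕ} where

  infixl 6 _⊖_
  infixl 7 _⊗ᶠ_

  Polynomial : Set
  Polynomial = Expr ℤ n

  Vectorᶠ : Set
  Vectorᶠ = Polynomial × Polynomial

  record Quaternionᶠ : Set where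
    constructor quaternionᶠ
    field reᶠ imᵢᶠ imⱼᶠ imₖᶠ : Polynomial

  open Quaternionᶠ public

  _⊖_ : Polynomial → Polynomial → Polynomial
  x ⊖ y = x ⊕ ⊝ y

  _⊗ᶠ_ : Quaternionᶠ → Quaternionᶠ → Quaternionᶠ
  quaternionᶠ a b c d ⊗ᶠ quaternionᶠ a′ b′ c′ d′ = quaternionᶠ
    (a ⊗ a′ ⊖ b ⊗ b′ ⊖ c ⊗ c′ ⊖ d ⊗ d′)
    (a ⊗ b′ ⊕ b ⊗ a′ ⊕ c ⊗ d′ ⊖ d ⊗ c′)
    (a ⊗ c′ ⊖ b ⊗ d′ ⊕ c ⊗ a′ ⊕ d ⊗ b′)
    (a ⊗ d′ ⊕ b ⊗ c′ ⊖ c ⊗ b′ ⊕ d ⊗ a′)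

  scaleᶠ : Polynomial → Quaternionᶠ → Quaternionᶠ
  scaleᶠ e (quaternionᶠ a b c d) = quaternionᶠ (e ⊗ a) (e ⊗ b) (e ⊗ c) (e ⊗ d)

  1ᶠ : Quaternionᶠ
  1ᶠ = quaternionᶠ (Κ 1ℤ) (Κ 0ℤ) (Κ 0ℤ) (Κ 0ℤ)

  conjᶠ : Quaternionᶠ → Quaternionᶠ
  conjᶠ (quaternionᶠ a b c d) = quaternionᶠ a (⊝ b) (⊝ c) (⊝ d)

  normᶠ : Quaternionᶠ → Polynomial
  normᶠ (quaternionᶠ a b c d) = a ⊗ a ⊕ b ⊗ b ⊕ c ⊗ c ⊕ d ⊗ d

  detᶠ dotᶠ permᶠ diffᶠ : Vectorᶠ → Vectorᶠ → Polynomial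
  detᶠ  (u₁ , u₂) (k₁ , k₂) = u₁ ⊗ k₂ ⊖ u₂ ⊗ k₁
  dotᶠ  (u₁ , u₂) (k₁ , k₂) = u₁ ⊗ k₁ ⊕ u₂ ⊗ k₂
  permᶠ (u₁ , u₂) (k₁ , k₂) = u₁ ⊗ k₂ ⊕ u₂ ⊗ k₁
  diffᶠ (u₁ , u₂) (k₁ , k₂) = u₂ ⊗ k₂ ⊖ u₁ ⊗ k₁

  dyadᶠ : Polynomial → Polynomial → Vectorᶠ → Vectorᶠ → Quaternionᶠ
  dyadᶠ α β u k = quaternionᶠ
    (detᶠ k u)
    (⊝ dotᶠ u k)
    (α ⊗ permᶠ u k ⊕ β ⊗ diffᶠ u k)
    (α ⊗ diffᶠ u k ⊖ β ⊗ permᶠ u k)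

  actᶠ : Polynomial → Polynomial → Quaternionᶠ → Vectorᶠ → Vectorᶠ
  actᶠ α β (quaternionᶠ a b c d) (u₁ , u₂) =
      (a ⊕ (c ⊗ α ⊖ d ⊗ β)) ⊗ u₁ ⊕ (c ⊗ β ⊕ d ⊗ α ⊖ b) ⊗ u₂
    , (c ⊗ β ⊕ d ⊗ α ⊕ b) ⊗ u₁ ⊕ (a ⊖ (c ⊗ α ⊖ d ⊗ β)) ⊗ u₂

  isotropyᶠ : Polynomial → Polynomial → Polynomial
  isotropyᶠ α β = α ⊗ α ⊕ β ⊗ β ⊕ Κ 1ℤ

open Formal

-- Scalar multiples, conjugation and the norm.

module _ {n : ℕ} where

  open Ring (ℤ/ n [i,j,k]) using (_≈_)

  •-cong : ∀ {c d x y} → c ≡ d [mod n ] → x ≈ y → c • x ≈ d • y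
  •-cong c≡d (components p q r s) = components
    (*-cong-mod c≡d p) (*-cong-mod c≡d q) (*-cong-mod c≡d r) (*-cong-mod c≡d s)

  •-congˡ : ∀ c {x y} → x ≈ y → c • x ≈ c • y
  •-congˡ c = •-cong (≡⇒≡[mod] {a = c} refl)

  •-zeroʳ : ∀ c → c • 0ᴴ ≈ 0ᴴ
  •-zeroʳ c = components c*0 c*0 c*0 c*0
    where
    c*0 : c ℤ.* 0ℤ ≡ 0ℤ [mod n ]
    c*0 = ≡⇒≡[mod] (ℤ.*-zeroʳ c)

  •-identity : ∀ x → 1ℤ • x ≈ x
  •-identity (quaternion a b c d) = components
    (≡⇒≡[mod] (ℤ.*-identityˡ a)) (≡⇒≡[mod] (ℤ.*-identityˡ b))
    (≡⇒≡[mod] (ℤ.*-identityˡ c)) (≡⇒≡[mod] (ℤ.*-identityˡ d))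

  •-assoc : ∀ e f x → (e ℤ.* f) • x ≈ e • f • x
  •-assoc e f (quaternion a b c d) = components
    (≡⇒≡[mod] (ℤ.*-assoc e f a)) (≡⇒≡[mod] (ℤ.*-assoc e f b))
    (≡⇒≡[mod] (ℤ.*-assoc e f c)) (≡⇒≡[mod] (ℤ.*-assoc e f d))

  •-*-assoc : ∀ e x y → (e • x) *ᴴ y ≈ e • (x *ᴴ y)
  •-*-assoc e (quaternion a b c d) (quaternion a′ b′ c′ d′) = components
    (≡⇒≡[mod] (solve 9 (λ e a b c d a′ b′ c′ d′ →
        reᶠ (scaleᶠ e (quaternionᶠ a b c d) ⊗ᶠ quaternionᶠ a′ b′ c′ d′) ⊜
        reᶠ (scaleᶠ e (quaternionᶠ a b c d ⊗ᶠ quaternionᶠ a′ b′ c′ d′)))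
      refl e a b c d a′ b′ c′ d′))
    (≡⇒≡[mod] (solve 9 (λ e a b c d a′ b′ c′ d′ →
        imᵢᶠ (scaleᶠ e (quaternionᶠ a b c d) ⊗ᶠ quaternionᶠ a′ b′ c′ d′) ⊜
        imᵢᶠ (scaleᶠ e (quaternionᶠ a b c d ⊗ᶠ quaternionᶠ a′ b′ c′ d′)))
      refl e a b c d a′ b′ c′ d′))
    (≡⇒≡[mod] (solve 9 (λ e a b c d a′ b′ c′ d′ →
        imⱼᶠ (scaleᶠ e (quaternionᶠ a b c d) ⊗ᶠ quaternionᶠ a′ b′ c′ d′) ⊜
        imⱼᶠ (scaleᶠ e (quaternionᶠ a b c d ⊗ᶠ quaternionᶠ a′ b′ c′ d′)))
      refl e a b c d a′ b′ c′ d′))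
    (≡⇒≡[mod] (solve 9 (λ e a b c d a′ b′ c′ d′ →
        imₖᶠ (scaleᶠ e (quaternionᶠ a b c d) ⊗ᶠ quaternionᶠ a′ b′ c′ d′) ⊜
        imₖᶠ (scaleᶠ e (quaternionᶠ a b c d ⊗ᶠ quaternionᶠ a′ b′ c′ d′)))
      refl e a b c d a′ b′ c′ d′))

  *-•-comm : ∀ e x y → x *ᴴ (e • y) ≈ e • (x *ᴴ y)
  *-•-comm e (quaternion a b c d) (quaternion a′ b′ c′ d′) = components
    (≡⇒≡[mod] (solve 9 (λ e a b c d a′ b′ c′ d′ →
        reᶠ (quaternionᶠ a b c d ⊗ᶠ scaleᶠ e (quaternionᶠ a′ b′ c′ d′)) ⊜
        reᶠ (scaleᶠ e (quaternionᶠ a b c d ⊗ᶠ quaternionᶠ a′ b′ c′ d′)))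
      refl e a b c d a′ b′ c′ d′))
    (≡⇒≡[mod] (solve 9 (λ e a b c d a′ b′ c′ d′ →
        imᵢᶠ (quaternionᶠ a b c d ⊗ᶠ scaleᶠ e (quaternionᶠ a′ b′ c′ d′)) ⊜
        imᵢᶠ (scaleᶠ e (quaternionᶠ a b c d ⊗ᶠ quaternionᶠ a′ b′ c′ d′)))
      refl e a b c d a′ b′ c′ d′))
    (≡⇒≡[mod] (solve 9 (λ e a b c d a′ b′ c′ d′ →
        imⱼᶠ (quaternionᶠ a b c d ⊗ᶠ scaleᶠ e (quaternionᶠ a′ b′ c′ d′)) ⊜
        imⱼᶠ (scaleᶠ e (quaternionᶠ a b c d ⊗ᶠ quaternionᶠ a′ b′ c′ d′)))
      refl e a b c d a′ b′ c′ d′))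
    (≡⇒≡[mod] (solve 9 (λ e a b c d a′ b′ c′ d′ →
        imₖᶠ (quaternionᶠ a b c d ⊗ᶠ scaleᶠ e (quaternionᶠ a′ b′ c′ d′)) ⊜
        imₖᶠ (scaleᶠ e (quaternionᶠ a b c d ⊗ᶠ quaternionᶠ a′ b′ c′ d′)))
      refl e a b c d a′ b′ c′ d′))

  conj-* : ∀ x → conj x *ᴴ x ≈ norm x • 1ᴴ
  conj-* (quaternion a b c d) = components
    (≡⇒≡[mod] (solve 4 (λ a b c d →
        reᶠ (conjᶠ (quaternionᶠ a b c d) ⊗ᶠ quaternionᶠ a b c d) ⊜
        reᶠ (scaleᶠ (normᶠ (quaternionᶠ a b c d)) 1ᶠ))
      refl a b c d))
    (≡⇒≡[mod] (solve 4 (λ a b c d →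
        imᵢᶠ (conjᶠ (quaternionᶠ a b c d) ⊗ᶠ quaternionᶠ a b c d) ⊜
        imᵢᶠ (scaleᶠ (normᶠ (quaternionᶠ a b c d)) 1ᶠ))
      refl a b c d))
    (≡⇒≡[mod] (solve 4 (λ a b c d →
        imⱼᶠ (conjᶠ (quaternionᶠ a b c d) ⊗ᶠ quaternionᶠ a b c d) ⊜
        imⱼᶠ (scaleᶠ (normᶠ (quaternionᶠ a b c d)) 1ᶠ))
      refl a b c d))
    (≡⇒≡[mod] (solve 4 (λ a b c d →
        imₖᶠ (conjᶠ (quaternionᶠ a b c d) ⊗ᶠ quaternionᶠ a b c d) ⊜
        imₖᶠ (scaleᶠ (normᶠ (quaternionᶠ a b c d)) 1ᶠ))
      refl a b c d))

  *-conj : ∀ x → x *ᴴ conj x ≈ norm x • 1ᴴ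
  *-conj (quaternion a b c d) = components
    (≡⇒≡[mod] (solve 4 (λ a b c d →
        reᶠ (quaternionᶠ a b c d ⊗ᶠ conjᶠ (quaternionᶠ a b c d)) ⊜
        reᶠ (scaleᶠ (normᶠ (quaternionᶠ a b c d)) 1ᶠ))
      refl a b c d))
    (≡⇒≡[mod] (solve 4 (λ a b c d →
        imᵢᶠ (quaternionᶠ a b c d ⊗ᶠ conjᶠ (quaternionᶠ a b c d)) ⊜
        imᵢᶠ (scaleᶠ (normᶠ (quaternionᶠ a b c d)) 1ᶠ))
      refl a b c d))
    (≡⇒≡[mod] (solve 4 (λ a b c d →
        imⱼᶠ (quaternionᶠ a b c d ⊗ᶠ conjᶠ (quaternionᶠ a b c d)) ⊜
        imⱼᶠ (scaleᶠ (normᶠ (quaternionᶠ a b c d)) 1ᶠ))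
      refl a b c d))
    (≡⇒≡[mod] (solve 4 (λ a b c d →
        imₖᶠ (quaternionᶠ a b c d ⊗ᶠ conjᶠ (quaternionᶠ a b c d)) ⊜
        imₖᶠ (scaleᶠ (normᶠ (quaternionᶠ a b c d)) 1ᶠ))
      refl a b c d))

-- Matrix identities modulo `α² + β² + 1`.

module Isotropic {n : ℕ} (α β : ℤ) (n∣α²+β²+1 : + n ∣ α ℤ.* α ℤ.+ β ℤ.* β ℤ.+ 1ℤ) where

  open Matrices α β
  open Ring (ℤ/ n [i,j,k]) using (_≈_; _-_)

  -- The matrix picture holds over the integers only up to multiples of `α² + β² + 1`. With the
  -- cofactor `c` given, an exact identity remains for the ring solver.
  modulo-isotropy : ∀ {a b} c →
                    a ℤ.- b ≡ c ℤ.* (α ℤ.* α ℤ.+ β ℤ.* β ℤ.+ 1ℤ) → a ≡ b [mod n ]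
  modulo-isotropy c eq = congruent (subst (+ n ∣_) (sym eq) (∣n⇒∣m*n c n∣α²+β²+1))

  -- Composing a map of rank one with `x` on the left moves the image vector `u` and keeps the
  -- linear form `det k`.
  *-dyad : ∀ x u k → x *ᴴ dyad u k ≈ dyad (act x u) k
  *-dyad (quaternion a b c d) u@(u₁ , u₂) k@(k₁ , k₂) = components
    (≡⇒≡[mod] (solve 10 (λ α β a b c d u₁ u₂ k₁ k₂ →
        let u = u₁ , u₂ ; k = k₁ , k₂ in
        reᶠ (quaternionᶠ a b c d ⊗ᶠ dyadᶠ α β u k) ⊜
        reᶠ (dyadᶠ α β (actᶠ α β (quaternionᶠ a b c d) u) k))
      refl α β a b c d u₁ u₂ k₁ k₂))
    (≡⇒≡[mod] (solve 10 (λ α β a b c d u₁ u₂ k₁ k₂ →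
        let u = u₁ , u₂ ; k = k₁ , k₂ in
        imᵢᶠ (quaternionᶠ a b c d ⊗ᶠ dyadᶠ α β u k) ⊜
        imᵢᶠ (dyadᶠ α β (actᶠ α β (quaternionᶠ a b c d) u) k))
      refl α β a b c d u₁ u₂ k₁ k₂))
    (modulo-isotropy (c ℤ.* det k u ℤ.- d ℤ.* dot u k)
      (solve 10 (λ α β a b c d u₁ u₂ k₁ k₂ →
        let u = u₁ , u₂ ; k = k₁ , k₂ in
        imⱼᶠ (quaternionᶠ a b c d ⊗ᶠ dyadᶠ α β u k) ⊖
        imⱼᶠ (dyadᶠ α β (actᶠ α β (quaternionᶠ a b c d) u) k) ⊜
        (c ⊗ detᶠ k u ⊖ d ⊗ dotᶠ u k) ⊗ isotropyᶠ α β)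
      refl α β a b c d u₁ u₂ k₁ k₂))
    (modulo-isotropy (d ℤ.* det k u ℤ.+ c ℤ.* dot u k)
      (solve 10 (λ α β a b c d u₁ u₂ k₁ k₂ →
        let u = u₁ , u₂ ; k = k₁ , k₂ in
        imₖᶠ (quaternionᶠ a b c d ⊗ᶠ dyadᶠ α β u k) ⊖
        imₖᶠ (dyadᶠ α β (actᶠ α β (quaternionᶠ a b c d) u) k) ⊜
        (d ⊗ detᶠ k u ⊕ c ⊗ dotᶠ u k) ⊗ isotropyᶠ α β)
      refl α β a b c d u₁ u₂ k₁ k₂))

  -- The middle vectors contract to the scalar `det k v`; as each dyad is twice a map of rank one,
  -- one factor 2 is left over.
  dyad-*-dyad : ∀ u k v w → dyad u k *ᴴ dyad v w ≈ (+ 2 ℤ.* det k v) • dyad u w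
  dyad-*-dyad u@(u₁ , u₂) k@(k₁ , k₂) v@(v₁ , v₂) w@(w₁ , w₂) = components
    (modulo-isotropy (ℤ.- (perm u k ℤ.* perm v w ℤ.+ diff u k ℤ.* diff v w))
      (solve 10 (λ α β u₁ u₂ k₁ k₂ v₁ v₂ w₁ w₂ →
        let u = u₁ , u₂ ; k = k₁ , k₂ ; v = v₁ , v₂ ; w = w₁ , w₂ in
        reᶠ (dyadᶠ α β u k ⊗ᶠ dyadᶠ α β v w) ⊖
        reᶠ (scaleᶠ (Κ (+ 2) ⊗ detᶠ k v) (dyadᶠ α β u w)) ⊜
        (⊝ (permᶠ u k ⊗ permᶠ v w ⊕ diffᶠ u k ⊗ diffᶠ v w)) ⊗ isotropyᶠ α β)
      refl α β u₁ u₂ k₁ k₂ v₁ v₂ w₁ w₂))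
    (modulo-isotropy (diff v w ℤ.* perm u k ℤ.- diff u k ℤ.* perm v w)
      (solve 10 (λ α β u₁ u₂ k₁ k₂ v₁ v₂ w₁ w₂ →
        let u = u₁ , u₂ ; k = k₁ , k₂ ; v = v₁ , v₂ ; w = w₁ , w₂ in
        imᵢᶠ (dyadᶠ α β u k ⊗ᶠ dyadᶠ α β v w) ⊖
        imᵢᶠ (scaleᶠ (Κ (+ 2) ⊗ detᶠ k v) (dyadᶠ α β u w)) ⊜
        (diffᶠ v w ⊗ permᶠ u k ⊖ diffᶠ u k ⊗ permᶠ v w) ⊗ isotropyᶠ α β)
      refl α β u₁ u₂ k₁ k₂ v₁ v₂ w₁ w₂))
    (≡⇒≡[mod] (solve 10 (λ α β u₁ u₂ k₁ k₂ v₁ v₂ w₁ w₂ →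
        let u = u₁ , u₂ ; k = k₁ , k₂ ; v = v₁ , v₂ ; w = w₁ , w₂ in
        imⱼᶠ (dyadᶠ α β u k ⊗ᶠ dyadᶠ α β v w) ⊜
        imⱼᶠ (scaleᶠ (Κ (+ 2) ⊗ detᶠ k v) (dyadᶠ α β u w)))
      refl α β u₁ u₂ k₁ k₂ v₁ v₂ w₁ w₂))
    (≡⇒≡[mod] (solve 10 (λ α β u₁ u₂ k₁ k₂ v₁ v₂ w₁ w₂ →
        let u = u₁ , u₂ ; k = k₁ , k₂ ; v = v₁ , v₂ ; w = w₁ , w₂ in
        imₖᶠ (dyadᶠ α β u k ⊗ᶠ dyadᶠ α β v w) ⊜
        imₖᶠ (scaleᶠ (Κ (+ 2) ⊗ detᶠ k v) (dyadᶠ α β u w)))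
      refl α β u₁ u₂ k₁ k₂ v₁ v₂ w₁ w₂))

  -- The imaginary coordinates of `dyad u k` are symmetric in `u` and `k`, and its real part is
  -- alternating, so only twice the real part survives.
  dyad-antisym : ∀ u k → dyad u k - dyad k u ≈ (+ 2 ℤ.* det k u) • 1ᴴ
  dyad-antisym (u₁ , u₂) (k₁ , k₂) = components
    (≡⇒≡[mod] (solve 6 (λ α β u₁ u₂ k₁ k₂ →
        let u = u₁ , u₂ ; k = k₁ , k₂ in
        reᶠ (dyadᶠ α β u k) ⊖ reᶠ (dyadᶠ α β k u) ⊜
        reᶠ (scaleᶠ (Κ (+ 2) ⊗ detᶠ k u) 1ᶠ))
      refl α β u₁ u₂ k₁ k₂))
    (≡⇒≡[mod] (solve 6 (λ α β u₁ u₂ k₁ k₂ →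
        let u = u₁ , u₂ ; k = k₁ , k₂ in
        imᵢᶠ (dyadᶠ α β u k) ⊖ imᵢᶠ (dyadᶠ α β k u) ⊜
        imᵢᶠ (scaleᶠ (Κ (+ 2) ⊗ detᶠ k u) 1ᶠ))
      refl α β u₁ u₂ k₁ k₂))
    (≡⇒≡[mod] (solve 6 (λ α β u₁ u₂ k₁ k₂ →
        let u = u₁ , u₂ ; k = k₁ , k₂ in
        imⱼᶠ (dyadᶠ α β u k) ⊖ imⱼᶠ (dyadᶠ α β k u) ⊜
        imⱼᶠ (scaleᶠ (Κ (+ 2) ⊗ detᶠ k u) 1ᶠ))
      refl α β u₁ u₂ k₁ k₂))
    (≡⇒≡[mod] (solve 6 (λ α β u₁ u₂ k₁ k₂ →
        let u = u₁ , u₂ ; k = k₁ , k₂ in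
        imₖᶠ (dyadᶠ α β u k) ⊖ imₖᶠ (dyadᶠ α β k u) ⊜
        imₖᶠ (scaleᶠ (Κ (+ 2) ⊗ detᶠ k u) 1ᶠ))
      refl α β u₁ u₂ k₁ k₂))

  -- Since `α² + β² = -1` modulo `n`, the determinant `a² + b² - (α² + β²) (c² + d²)` of the matrix
  -- of a quaternion is its norm.
  det-matrix : ∀ a b c d →
    (a ℤ.+ (c ℤ.* α ℤ.- d ℤ.* β)) ℤ.* (a ℤ.- (c ℤ.* α ℤ.- d ℤ.* β)) ℤ.-
    (c ℤ.* β ℤ.+ d ℤ.* α ℤ.- b) ℤ.* (c ℤ.* β ℤ.+ d ℤ.* α ℤ.+ b)
    ≡ norm (quaternion a b c d) [mod n ]
  det-matrix a b c d = modulo-isotropy (ℤ.- (c ℤ.* c ℤ.+ d ℤ.* d))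
    (solve 6 (λ α β a b c d →
      ((a ⊕ (c ⊗ α ⊖ d ⊗ β)) ⊗ (a ⊖ (c ⊗ α ⊖ d ⊗ β))
        ⊖ (c ⊗ β ⊕ d ⊗ α ⊖ b) ⊗ (c ⊗ β ⊕ d ⊗ α ⊕ b))
      ⊖ normᶠ (quaternionᶠ a b c d)
      ⊜ (⊝ (c ⊗ c ⊕ d ⊗ d)) ⊗ isotropyᶠ α β) refl
      α β a b c d)

-- Residues and inverses modulo `n`.

∣⇒≡0[mod] : ∀ {n a} → + n ∣ a → a ≡ 0ℤ [mod n ]
∣⇒≡0[mod] {n} {a} = congruent ∘ subst (+ n ∣_) (sym (ℤ.+-identityʳ a))

≡0[mod]⇒∣ : ∀ {n a} → a ≡ 0ℤ [mod n ] → + n ∣ a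
≡0[mod]⇒∣ {n} {a} = subst (+ n ∣_) (ℤ.+-identityʳ a) ∘ n∣a-b

∣-+-+⇒≡ : ∀ {n a b} → a ℕ.< n → b ℕ.< n → + n ∣ + a ℤ.- + b → a ≡ b
∣-+-+⇒≡ {n} {a} {b} a<n b<n n∣a-b = ℤ.+-injective (ℤ.i-j≡0⇒i≡j _ _ (ℤ.∣i∣≡0⇒i≡0 ∣a-b∣≡0))
  where
  ∣m-n∣≡n∸m : ∀ {m n} → m ℕ.≤ n → ∣ + m ℤ.- + n ∣ ≡ n ℕ.∸ m
  ∣m-n∣≡n∸m {m} {n} m≤n = trans (cong ∣_∣ (ℤ.m-n≡m⊖n m n)) (ℤ.∣⊖∣-≤ m≤n)
  ∣a-b∣<n : ∣ + a ℤ.- + b ∣ ℕ.< n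
  ∣a-b∣<n with ℕ.≤-total a b
  ... | inj₁ a≤b = subst (ℕ._< n) (sym (∣m-n∣≡n∸m a≤b)) (ℕ.≤-<-trans (ℕ.m∸n≤m b a) b<n)
  ... | inj₂ b≤a = subst (ℕ._< n)
    (sym (trans (ℤ.∣i-j∣≡∣j-i∣ (+ a) (+ b)) (∣m-n∣≡n∸m b≤a))) (ℕ.≤-<-trans (ℕ.m∸n≤m a b) a<n)
  ∣a-b∣≡0 : ∣ + a ℤ.- + b ∣ ≡ 0
  ∣a-b∣≡0 with ∣ + a ℤ.- + b ∣ in eq
  ... | zero  = refl
  ... | suc m = contradiction
    (subst (n ℕ.∣_) eq (∣⇒∣ᵤ n∣a-b)) (ℕ.>⇒∤ (subst (ℕ._< n) eq ∣a-b∣<n))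

residue : ∀ {n} .{{_ : NonZero n}} a → ∃[ t ] a ≡ + toℕ {n} t [mod n ]
residue {n} a = fromℕ< (n%ℕd<d a n) , congruent (divides (a /ℕ n)
  (trans (cong (λ t → a ℤ.- + t) (toℕ-fromℕ< (n%ℕd<d a n)))
         (trans (cong (ℤ._- + (a %ℕ n)) (a≡a%ℕn+[a/ℕn]*n a n)) (cancel (+ (a %ℕ n)) _))))
  where
  cancel : ∀ r q → (r ℤ.+ q) ℤ.- r ≡ q
  cancel = solve-∀

-- Bézout's identity; over the natural numbers it comes in two forms, and the sign of the inverse
-- depends on which one holds.
inverse : ∀ {n} c → Coprime n ∣ c ∣ → ∃[ d ] d ℤ.* c ≡ 1ℤ [mod n ]
inverse {n} (+ k) n⊥c with coprime-Bézout n⊥c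
-- Here `1 + y * k = x * n`, so `- y` is the inverse.
... | Bézout.+- x y eq = ℤ.- + y , congruent (divides (ℤ.- + x) (begin
  (ℤ.- + y) ℤ.* + k ℤ.- 1ℤ    ≡⟨ rearrange (+ y) (+ k) ⟩
  ℤ.- (1ℤ ℤ.+ + y ℤ.* + k)    ≡⟨ cong (λ z → ℤ.- (1ℤ ℤ.+ z)) (ℤ.pos-* y k) ⟨
  ℤ.- (+ (1 ℕ.+ y ℕ.* k))     ≡⟨ cong (λ z → ℤ.- (+ z)) eq ⟩
  ℤ.- (+ (x ℕ.* n))           ≡⟨ cong ℤ.-_ (ℤ.pos-* x n) ⟩
  ℤ.- (+ x ℤ.* + n)           ≡⟨ ℤ.neg-distribˡ-* (+ x) (+ n) ⟩
  (ℤ.- + x) ℤ.* + n           ∎))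
  where
  open ≡-Reasoning
  rearrange : ∀ y k → (ℤ.- y) ℤ.* k ℤ.- 1ℤ ≡ ℤ.- (1ℤ ℤ.+ y ℤ.* k)
  rearrange = solve-∀
... | Bézout.-+ x y eq = + y , congruent (divides (+ x) (begin
  + y ℤ.* + k ℤ.- 1ℤ             ≡⟨ cong (ℤ._- 1ℤ) (ℤ.pos-* y k) ⟨
  + (y ℕ.* k) ℤ.- 1ℤ             ≡⟨ cong (λ z → + z ℤ.- 1ℤ) eq ⟨
  + (1 ℕ.+ x ℕ.* n) ℤ.- 1ℤ       ≡⟨ cong (λ z → 1ℤ ℤ.+ z ℤ.- 1ℤ) (ℤ.pos-* x n) ⟩
  1ℤ ℤ.+ + x ℤ.* + n ℤ.- 1ℤ      ≡⟨ rearrange (+ x ℤ.* + n) ⟩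
  + x ℤ.* + n                    ∎))
  where
  open ≡-Reasoning
  rearrange : ∀ z → 1ℤ ℤ.+ z ℤ.- 1ℤ ≡ z
  rearrange = solve-∀
inverse {n} -[1+ k ] n⊥c with d , dk≡1 ← inverse (+ suc k) n⊥c =
  ℤ.- d , subst (_≡ 1ℤ [mod n ]) (neg-* d (+ suc k)) dk≡1
  where
  neg-* : ∀ d k → d ℤ.* k ≡ (ℤ.- d) ℤ.* (ℤ.- k)
  neg-* = solve-∀

coprime-* : ∀ {m n k} → Coprime m k → Coprime n k → Coprime (m ℕ.* n) k
coprime-* m⊥k n⊥k (d∣mn , d∣k) = n⊥k
  (coprime-divisor (λ (e∣d , e∣m) → m⊥k (e∣m , ℕ.∣-trans e∣d d∣k)) d∣mn , d∣k)

-- Divisibility by a prime, and `-1` as a sum of two squares.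

module _ {p} (p-prime : Prime p) where

  private instance
    p≢0 = prime⇒nonZero p-prime

  ∤⇒coprime : ∀ {c} → ¬ + p ∣ c → Coprime p ∣ c ∣
  ∤⇒coprime p∤c (d∣p , d∣c) with prime⇒irreducible p-prime d∣p
  ... | inj₁ d≡1  = d≡1
  ... | inj₂ refl = contradiction (∣ᵤ⇒∣ d∣c) p∤c

  ∤⇒coprime-^ : ∀ s {c} → ¬ + p ∣ c → Coprime (p ^ s) ∣ c ∣
  ∤⇒coprime-^ zero    p∤c = 1-coprimeTo _
  ∤⇒coprime-^ (suc s) p∤c = coprime-* (∤⇒coprime p∤c) (∤⇒coprime-^ s p∤c)

  ∣*⇒∣⊎∣ : ∀ a b → + p ∣ a ℤ.* b → (+ p ∣ a) ⊎ (+ p ∣ b)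
  ∣*⇒∣⊎∣ a b p∣ab
    with euclidsLemma ∣ a ∣ ∣ b ∣ p-prime (subst (p ℕ.∣_) (ℤ.abs-* a b) (∣⇒∣ᵤ p∣ab))
  ... | inj₁ p∣a = inj₁ (∣ᵤ⇒∣ p∣a)
  ... | inj₂ p∣b = inj₂ (∣ᵤ⇒∣ p∣b)

  -- Pigeonhole: among the h + 1 squares a² and the h + 1 values -1 - b²
  -- with 0 ≤ a , b ≤ h there are two congruent ones.

  sum-of-squares≡-1 : ∀ h → p ≡ suc (h ℕ.+ h) →
                      ∃₂ λ α β → + p ∣ α ℤ.* α ℤ.+ β ℤ.* β ℤ.+ 1ℤ
  sum-of-squares≡-1 h p≡1+h+h =
    let i , j , i<j , eq = pigeonhole p<2[1+h] (residueOf ∘ value ∘ splitAt (suc h))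
    in collision (splitAt (suc h) i) (splitAt (suc h) j)
         (<⇒≢ i<j ∘ λ eq → trans (sym (join-splitAt (suc h) _ i))
                             (trans (cong (join (suc h) _) eq) (join-splitAt (suc h) _ j)))
         (residueOf-injective _ _ eq)
    where
    open IsEquivalence (≡[mod]-isEquivalence {p}) using ()
      renaming (sym to ≡-sym; trans to ≡-trans)
    p<2[1+h] : p ℕ.< suc h ℕ.+ suc h
    p<2[1+h] = s≤s (ℕ.≤-reflexive (trans p≡1+h+h (sym (ℕ.+-suc h h))))
    residueOf : ℤ → Fin p
    residueOf a = proj₁ (residue a)
    residueOf-injective : ∀ a b → residueOf a ≡ residueOf b → a ≡ b [mod p ]
    residueOf-injective a b eq = ≡-trans (proj₂ (residue a))
      (≡-sym (subst (λ t → b ≡ + toℕ t [mod p ]) (sym eq) (proj₂ (residue b))))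
    value : Fin (suc h) ⊎ Fin (suc h) → ℤ
    value (inj₁ a) = + toℕ a ℤ.* + toℕ a
    value (inj₂ b) = ℤ.- (+ toℕ b ℤ.* + toℕ b) ℤ.- 1ℤ
    squares : ∀ (a b : Fin (suc h)) →
              + p ∣ + toℕ a ℤ.* + toℕ a ℤ.- + toℕ b ℤ.* + toℕ b → a ≡ b
    squares a b p∣a²-b² = toℕ-injective
      (case ∣*⇒∣⊎∣ (+ toℕ a ℤ.- + toℕ b) (+ toℕ a ℤ.+ + toℕ b)
             (subst (+ p ∣_) (factor (+ toℕ a) (+ toℕ b)) p∣a²-b²) of λ where
        (inj₁ p∣a-b) → ∣-+-+⇒≡ (<p a) (<p b) p∣a-b
        -- `a + b ≤ 2 h < p`, so the sum is zero and with it both summands.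
        (inj₂ p∣a+b) →
          let a+b≡0 = ∣-+-+⇒≡ a+b<p 0<p (subst (+ p ∣_) (sym (ℤ.+-identityʳ _)) p∣a+b)
          in trans (ℕ.m+n≡0⇒m≡0 _ a+b≡0) (sym (ℕ.m+n≡0⇒n≡0 (toℕ a) a+b≡0)))
      where
      factor : ∀ a b → a ℤ.* a ℤ.- b ℤ.* b ≡ (a ℤ.- b) ℤ.* (a ℤ.+ b)
      factor = solve-∀
      ≤h : (c : Fin (suc h)) → toℕ c ℕ.≤ h
      ≤h c = ℕ.s≤s⁻¹ (toℕ<n c)
      a+b<p : toℕ a ℕ.+ toℕ b ℕ.< p
      a+b<p = subst (toℕ a ℕ.+ toℕ b ℕ.<_) (sym p≡1+h+h) (s≤s (ℕ.+-mono-≤ (≤h a) (≤h b)))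
      0<p : 0 ℕ.< p
      0<p = ℕ.>-nonZero⁻¹ p
      <p : (c : Fin (suc h)) → toℕ c ℕ.< p
      <p c = subst (toℕ c ℕ.<_) (sym p≡1+h+h) (s≤s (ℕ.≤-trans (≤h c) (ℕ.m≤m+n h h)))
    collision : ∀ s t → s ≢ t → value s ≡ value t [mod p ] →
                ∃₂ λ α β → + p ∣ α ℤ.* α ℤ.+ β ℤ.* β ℤ.+ 1ℤ
    collision (inj₁ a) (inj₁ b) s≢t eq =
      contradiction (cong inj₁ (squares a b (n∣a-b eq))) s≢t
    collision (inj₁ a) (inj₂ b) s≢t eq = + toℕ a , + toℕ b ,
      subst (+ p ∣_) (rearrange (+ toℕ a) (+ toℕ b)) (n∣a-b eq)
      where
      rearrange : ∀ a b → a ℤ.* a ℤ.- (ℤ.- (b ℤ.* b) ℤ.- 1ℤ) ≡ a ℤ.* a ℤ.+ b ℤ.* b ℤ.+ 1ℤ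
      rearrange = solve-∀
    collision (inj₂ b) (inj₁ a) s≢t eq = collision (inj₁ a) (inj₂ b) (s≢t ∘ sym) (≡-sym eq)
    collision (inj₂ a) (inj₂ b) s≢t eq =
      contradiction (cong inj₂ (sym (squares b a
        (subst (+ p ∣_) (rearrange (+ toℕ a) (+ toℕ b)) (n∣a-b eq))))) s≢t
      where
      rearrange : ∀ a b → (ℤ.- (a ℤ.* a) ℤ.- 1ℤ) ℤ.- (ℤ.- (b ℤ.* b) ℤ.- 1ℤ)
                  ≡ b ℤ.* b ℤ.- a ℤ.* a
      rearrange = solve-∀

odd⇒≡1+h+h : ∀ {n} → ¬ 2 ℕ.∣ n → ∃[ h ] n ≡ suc (h ℕ.+ h)
odd⇒≡1+h+h {n} 2∤n with n ℕ.% 2 in eq | ℕ.m≡m%n+[m/n]*n n 2 | ℕ.m%n<n n 2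
... | 0           | _  | _           = contradiction (ℕ.m%n≡0⇒n∣m n 2 eq) 2∤n
... | 1           | n≡ | _           = n ℕ./ 2 , trans n≡ (cong suc
  (trans (ℕ.*-comm (n ℕ./ 2) 2) (cong (n ℕ./ 2 ℕ.+_) (ℕ.+-identityʳ (n ℕ./ 2)))))
... | suc (suc _) | _  | s≤s (s≤s ())

-- Decidable congruence and change of modulus.

infix 4 _≉ᴴ_[mod_] _≡?_[mod_] _≈ᴴ?_[mod_]

_≉ᴴ_[mod_] : Quaternion → Quaternion → ℕ → Set
x ≉ᴴ y [mod n ] = ¬ x ≈ᴴ y [mod n ]

_≡?_[mod_] : ∀ a b n → Dec (a ≡ b [mod n ])
a ≡? b [mod n ] = map′ congruent n∣a-b (+ n ∣? a ℤ.- b)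

_≈ᴴ?_[mod_] : ∀ x y n → Dec (x ≈ᴴ y [mod n ])
x ≈ᴴ? y [mod n ] = map′
  (λ (p , q , r , s) → components p q r s)
  (λ (components p q r s) → p , q , r , s)
  ((re x ≡? re y [mod n ]) ×-dec (imᵢ x ≡? imᵢ y [mod n ]) ×-dec
   (imⱼ x ≡? imⱼ y [mod n ]) ×-dec (imₖ x ≡? imₖ y [mod n ]))

≈ᴴ-reduce : ∀ {m n x y} → m ℕ.∣ n → x ≈ᴴ y [mod n ] → x ≈ᴴ y [mod m ]
≈ᴴ-reduce {m} {n} m∣n (components p q r s) =
  components (reduce p) (reduce q) (reduce r) (reduce s)
  where
  reduce : ∀ {a b} → a ≡ b [mod n ] → a ≡ b [mod m ]
  reduce = congruent ∘ ∣-trans (∣ᵤ⇒∣ m∣n) ∘ n∣a-b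

module _ (n : ℕ) {m : ℕ} where

  private
    *-distribˡ-- : ∀ c a b → c ℤ.* (a ℤ.- b) ≡ c ℤ.* a ℤ.- c ℤ.* b
    *-distribˡ-- = solve-∀

  •-lift : ∀ {x y} → x ≈ᴴ y [mod m ] → + n • x ≈ᴴ + n • y [mod n ℕ.* m ]
  •-lift (components p q r s) = components (lift p) (lift q) (lift r) (lift s)
    where
    lift : ∀ {a b} → a ≡ b [mod m ] → + n ℤ.* a ≡ + n ℤ.* b [mod n ℕ.* m ]
    lift {a} {b} = congruent ∘
      subst₂ _∣_ (sym (ℤ.pos-* n m)) (*-distribˡ-- (+ n) a b) ∘ *-monoʳ-∣ (+ n) ∘ n∣a-b

  •-lower : ∀ {x y} .{{_ : NonZero n}} → + n • x ≈ᴴ + n • y [mod n ℕ.* m ] → x ≈ᴴ y [mod m ]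
  •-lower (components p q r s) = components (lower p) (lower q) (lower r) (lower s)
    where
    lower : ∀ {a b} → + n ℤ.* a ≡ + n ℤ.* b [mod n ℕ.* m ] → a ≡ b [mod m ]
    lower {a} {b} = congruent ∘
      *-cancelˡ-∣ (+ n) ∘ subst₂ _∣_ (ℤ.pos-* n m) (sym (*-distribˡ-- (+ n) a b)) ∘ n∣a-b

-- The equation is an exact one between integer quaternions, so `x` may be replaced by the multiple
-- outright.
≈0⇒multiple : ∀ {n x} → x ≈ᴴ 0ᴴ [mod n ] → ∃[ y ] x ≡ + n • y
≈0⇒multiple {n} {quaternion a b c d} (components p q r s) =
  quaternion (quot p) (quot q) (quot r) (quot s) ,
  cong₂ (λ where (a , b) (c , d) → quaternion a b c d)
    (cong₂ _,_ (eq p) (eq q)) (cong₂ _,_ (eq r) (eq s))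
  where
  quot : ∀ {a} → a ≡ 0ℤ [mod n ] → ℤ
  quot = quotient ∘ ≡0[mod]⇒∣
  eq : ∀ {a} (a≡0 : a ≡ 0ℤ [mod n ]) → a ≡ + n ℤ.* quot a≡0
  eq a≡0 = trans (_∣_.equality (≡0[mod]⇒∣ a≡0)) (ℤ.*-comm (quot a≡0) (+ n))

•-cancel-unit : ∀ {n} c {x} → Coprime n ∣ c ∣ → c • x ≈ᴴ 0ᴴ [mod n ] → x ≈ᴴ 0ᴴ [mod n ]
•-cancel-unit {n} c {x} n⊥c cx≈0 with d , dc≡1 ← inverse c n⊥c = begin
  x              ≈⟨ •-identity x ⟨
  1ℤ • x         ≈⟨ •-cong dc≡1 H.refl ⟨
  (d ℤ.* c) • x  ≈⟨ •-assoc d c x ⟩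
  d • c • x      ≈⟨ •-congˡ d cx≈0 ⟩
  d • 0ᴴ         ≈⟨ •-zeroʳ d ⟩
  0ᴴ             ∎
  where
  module H = Ring (ℤ/ n [i,j,k])
  open ≈-Reasoning H.setoid

-- Primitive parts, and norms of zero divisors.

module _ {p} (p-prime : Prime p) where

  private instance
    p≢0 = prime⇒nonZero p-prime

  -- part is x / pᵛ with v as large as possible.

  record PrimitivePart (s : ℕ) (x : Quaternion) : Set where
    field
      part          : Quaternion
      part≉0        : part ≉ᴴ 0ᴴ [mod p ]
      annihilatesʳ  : ∀ z → x *ᴴ z ≈ᴴ 0ᴴ [mod p ^ s ] → part *ᴴ z ≈ᴴ 0ᴴ [mod p ]
      annihilatesˡ  : ∀ z → z *ᴴ x ≈ᴴ 0ᴴ [mod p ^ s ] → z *ᴴ part ≈ᴴ 0ᴴ [mod p ]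
      part-of-unit  : x ≉ᴴ 0ᴴ [mod p ] → part ≡ x

  -- Induction on the exponent. If `p` divides `x`, then `x / p` is still nonzero modulo the next
  -- lower power, and annihilation descends by the same division.
  primitivePart : ∀ s {x} → x ≉ᴴ 0ᴴ [mod p ^ s ] → PrimitivePart s x
  -- Modulo `p ^ 0 = 1` everything vanishes, against `x≉0`; thus the division by `p` stops in time.
  primitivePart zero {x} x≉0 = contradiction (components ≡0 ≡0 ≡0 ≡0) x≉0
    where
    ≡0 : ∀ {a} → a ≡ 0ℤ [mod 1 ]
    ≡0 = ∣⇒≡0[mod] (∣ᵤ⇒∣ (ℕ.1∣ _))
  primitivePart (suc s) {x} x≉0 with x ≈ᴴ? 0ᴴ [mod p ]
  ... | no x≉0ₚ = record
    { part         = x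
    ; part≉0       = x≉0ₚ
    ; annihilatesʳ = λ _ → ≈ᴴ-reduce (ℕ.m∣m*n (p ^ s))
    ; annihilatesˡ = λ _ → ≈ᴴ-reduce (ℕ.m∣m*n (p ^ s))
    ; part-of-unit = λ _ → refl
    }
  ... | yes x≈0ₚ with x′ , refl ← ≈0⇒multiple x≈0ₚ = record
    { part         = part
    ; part≉0       = part≉0
    ; annihilatesʳ = λ z xz≈0 → annihilatesʳ z (•-lower p (begin
        + p • (x′ *ᴴ z)  ≈⟨ •-*-assoc (+ p) x′ z ⟨
        (+ p • x′) *ᴴ z  ≈⟨ xz≈0 ⟩
        0ᴴ               ≈⟨ •-zeroʳ (+ p) ⟨
        + p • 0ᴴ         ∎))
    ; annihilatesˡ = λ z zx≈0 → annihilatesˡ z (•-lower p (begin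
        + p • (z *ᴴ x′)  ≈⟨ *-•-comm (+ p) z x′ ⟨
        z *ᴴ (+ p • x′)  ≈⟨ zx≈0 ⟩
        0ᴴ               ≈⟨ •-zeroʳ (+ p) ⟨
        + p • 0ᴴ         ∎))
    ; part-of-unit = contradiction x≈0ₚ
    }
    where
    module H = Ring (ℤ/ (p ^ suc s) [i,j,k])
    open ≈-Reasoning H.setoid
    open PrimitivePart (primitivePart s
      (λ x′≈0 → x≉0 (H.trans (•-lift p x′≈0) (•-zeroʳ (+ p)))))

  -- If `p` does not divide the norm, the norm is a unit modulo `p ^ s`; multiplying `x * y = 0` or
  -- `y * x = 0` by the conjugate of `x` then gives `y = 0`.
  zeroDivisor⇒∣norm : ∀ s {x} → IsZeroDivisor (ℤ/ (p ^ s) [i,j,k]) x → + p ∣ norm x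
  zeroDivisor⇒∣norm s {x} x-zd = decidable-stable (+ p ∣? norm x) λ p∤N →
    let cancel : ∀ {y} → norm x • y ≈ᴴ 0ᴴ [mod p ^ s ] → y ≈ᴴ 0ᴴ [mod p ^ s ]
        cancel = •-cancel-unit (norm x) (∤⇒coprime-^ p-prime s p∤N) in
    case x-zd of λ where
      (inj₁ (y , y≉0 , xy≈0)) → y≉0 (cancel (begin
        norm x • y             ≈⟨ •-congˡ (norm x) (H.*-identityˡ y) ⟨
        norm x • (1ᴴ *ᴴ y)     ≈⟨ •-*-assoc (norm x) 1ᴴ y ⟨
        (norm x • 1ᴴ) *ᴴ y     ≈⟨ H.*-congʳ (conj-* x) ⟨
        conj x *ᴴ x *ᴴ y       ≈⟨ H.*-assoc (conj x) x y ⟩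
        conj x *ᴴ (x *ᴴ y)     ≈⟨ H.*-congˡ {x = conj x} xy≈0 ⟩
        conj x *ᴴ 0ᴴ           ≈⟨ H.zeroʳ (conj x) ⟩
        0ᴴ                     ∎))
      (inj₂ (y , y≉0 , yx≈0)) → y≉0 (cancel (begin
        norm x • y             ≈⟨ •-congˡ (norm x) (H.*-identityʳ y) ⟨
        norm x • (y *ᴴ 1ᴴ)     ≈⟨ *-•-comm (norm x) y 1ᴴ ⟨
        y *ᴴ (norm x • 1ᴴ)     ≈⟨ H.*-congˡ {x = y} (*-conj x) ⟨
        y *ᴴ (x *ᴴ conj x)     ≈⟨ H.*-assoc y x (conj x) ⟨
        y *ᴴ x *ᴴ conj x       ≈⟨ H.*-congʳ yx≈0 ⟩
        0ᴴ *ᴴ conj x           ≈⟨ H.zeroˡ (conj x) ⟩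
        0ᴴ                     ∎))
    where
    module H = Ring (ℤ/ (p ^ s) [i,j,k])
    open ≈-Reasoning H.setoid

-- The projective line over `ℤ/p`, and kernels of singular matrices.

-- Representatives of the p + 1 points of the projective line over ℤ/p.

line : ∀ {p} → Fin (suc p) → Vector
line zero    = 0ℤ , 1ℤ
line (suc t) = 1ℤ , + toℕ t

other : ∀ {p} → Fin (2 ℕ.+ p) → Fin (2 ℕ.+ p)
other zero    = suc zero
other (suc _) = zero

other-≢ : ∀ {p} (L : Fin (2 ℕ.+ p)) → other L ≢ L
other-≢ zero    ()
other-≢ (suc _) ()

module _ {p} (p-prime : Prime p) where

  private instance
    p≢0 = prime⇒nonZero p-prime

  ∤1 : ¬ + p ∣ 1ℤ
  ∤1 p∣1 = prime⇒≢1 (ℕ.∣1⇒≡1 (∣⇒∣ᵤ p∣1))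
    where
    prime⇒≢1 : p ≢ 1
    prime⇒≢1 = ℕ.nonTrivial⇒≢1 {{prime⇒nonTrivial p-prime}}

  -- For distinct representatives the determinant is `±1` or a nonzero difference of two residues
  -- below `p`.
  ∣det-line⇒≡ : ∀ (L M : Fin (suc p)) → + p ∣ det (line L) (line M) → L ≡ M
  ∣det-line⇒≡ zero    zero    _   = refl
  ∣det-line⇒≡ zero    (suc _) p∣d = contradiction (∣m⇒∣-m p∣d) ∤1
  ∣det-line⇒≡ (suc t) zero    p∣d = contradiction (subst (+ p ∣_) (simplify (+ toℕ t)) p∣d) ∤1
    where
    simplify : ∀ t → 1ℤ ℤ.* 1ℤ ℤ.- t ℤ.* 0ℤ ≡ 1ℤ
    simplify = solve-∀
  ∣det-line⇒≡ (suc t) (suc u) p∣d = cong suc (sym (toℕ-injective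
    (∣-+-+⇒≡ (toℕ<n u) (toℕ<n t) (subst (+ p ∣_) (simplify (+ toℕ u) (+ toℕ t)) p∣d))))
    where
    simplify : ∀ u t → 1ℤ ℤ.* u ℤ.- t ℤ.* 1ℤ ≡ u ℤ.- t
    simplify = solve-∀

  -- `t = - a / b` solves the first equation. The second follows from
  -- `b (c + d t) = d (a + b t) - (a d - b c)`, as `p` does not divide `b`.
  kernel-suc : ∀ a b c d → ¬ + p ∣ b → + p ∣ a ℤ.* d ℤ.- b ℤ.* c →
    ∃[ t ] (+ p ∣ a ℤ.* 1ℤ ℤ.+ b ℤ.* + toℕ {p} t) × (+ p ∣ c ℤ.* 1ℤ ℤ.+ d ℤ.* + toℕ t)
  kernel-suc a b c d p∤b p∣ad-bc = t , p∣a+bt ,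
    ([ (λ p∣b → contradiction p∣b p∤b) , (λ p∣c+dt → p∣c+dt) ]′
       (∣*⇒∣⊎∣ p-prime b _ (subst (+ p ∣_) (second a b c d (+ toℕ t))
         (∣m∣n⇒∣m-n (∣n⇒∣m*n d p∣a+bt) p∣ad-bc))))
    where
    b⁻¹ = proj₁ (inverse b (∤⇒coprime p-prime p∤b))
    t = proj₁ (residue {p} (ℤ.- (b⁻¹ ℤ.* a)))
    first : ∀ a b b⁻¹ t → ℤ.- (a ℤ.* (b⁻¹ ℤ.* b ℤ.- 1ℤ)) ℤ.- b ℤ.* (ℤ.- (b⁻¹ ℤ.* a) ℤ.- t)
            ≡ a ℤ.* 1ℤ ℤ.+ b ℤ.* t
    first = solve-∀
    second : ∀ a b c d t → d ℤ.* (a ℤ.* 1ℤ ℤ.+ b ℤ.* t) ℤ.- (a ℤ.* d ℤ.- b ℤ.* c)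
             ≡ b ℤ.* (c ℤ.* 1ℤ ℤ.+ d ℤ.* t)
    second = solve-∀
    p∣a+bt : + p ∣ a ℤ.* 1ℤ ℤ.+ b ℤ.* + toℕ t
    p∣a+bt = subst (+ p ∣_) (first a b b⁻¹ (+ toℕ t)) (∣m∣n⇒∣m-n
      (∣m⇒∣-m (∣n⇒∣m*n a (n∣a-b (proj₂ (inverse b (∤⇒coprime p-prime p∤b))))))
      (∣n⇒∣m*n b (n∣a-b (proj₂ (residue {p} (ℤ.- (b⁻¹ ℤ.* a)))))))

  -- An entry of the second column prime to `p` yields a kernel vector `(1 , t)`; if that column
  -- vanishes modulo `p`, then `(0 , 1)` is in the kernel.
  kernel : ∀ a b c d → + p ∣ a ℤ.* d ℤ.- b ℤ.* c →
    ∃[ L ] let u₁ , u₂ = line {p} L in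
      (+ p ∣ a ℤ.* u₁ ℤ.+ b ℤ.* u₂) × (+ p ∣ c ℤ.* u₁ ℤ.+ d ℤ.* u₂)
  kernel a b c d p∣ad-bc with + p ∣? b | + p ∣? d
  ... | no p∤b  | _ =
    let t , p∣₁ , p∣₂ = kernel-suc a b c d p∤b p∣ad-bc in suc t , p∣₁ , p∣₂
  ... | yes _   | no p∤d =
    let t , p∣₂ , p∣₁ = kernel-suc c d a b p∤d
          (subst (+ p ∣_) (swap-rows a b c d) (∣m⇒∣-m p∣ad-bc))
    in suc t , p∣₁ , p∣₂
    where
    swap-rows : ∀ a b c d → ℤ.- (a ℤ.* d ℤ.- b ℤ.* c) ≡ c ℤ.* b ℤ.- d ℤ.* a
    swap-rows = solve-∀
  ... | yes p∣b | yes p∣d =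
    zero , subst (+ p ∣_) (simplify a b) p∣b , subst (+ p ∣_) (simplify c d) p∣d
    where
    simplify : ∀ a b → b ≡ a ℤ.* 0ℤ ℤ.+ b ℤ.* 1ℤ
    simplify = solve-∀

-- Annihilation among the dyads of lines.

module Dyads {p-2} (p-prime : Prime (2 ℕ.+ p-2)) (p∤2 : ¬ + (2 ℕ.+ p-2) ∣ + 2)
  (α β : ℤ) (p∣α²+β²+1 : + (2 ℕ.+ p-2) ∣ α ℤ.* α ℤ.+ β ℤ.* β ℤ.+ 1ℤ)
  where

  private
    p = 2 ℕ.+ p-2
    module H = Ring (ℤ/ p [i,j,k])

  open ≈-Reasoning H.setoid
  open Isotropic α β p∣α²+β²+1
  open Matrices α β

  ∣⇒dyad≈0 : ∀ {u} k → + p ∣ proj₁ u → + p ∣ proj₂ u → dyad u k H.≈ 0ᴴ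
  ∣⇒dyad≈0 (k₁ , k₂) p∣u₁ p∣u₂ = components
    (∣⇒≡0[mod] (∣m∣n⇒∣m-n (∣n⇒∣m*n k₁ p∣u₂) (∣n⇒∣m*n k₂ p∣u₁)))
    (∣⇒≡0[mod] (∣m⇒∣-m (∣m∣n⇒∣m+n (∣m⇒∣m*n k₁ p∣u₁) (∣m⇒∣m*n k₂ p∣u₂))))
    (∣⇒≡0[mod] (∣m∣n⇒∣m+n (∣n⇒∣m*n α p∣P) (∣n⇒∣m*n β p∣Q)))
    (∣⇒≡0[mod] (∣m∣n⇒∣m-n (∣n⇒∣m*n α p∣Q) (∣n⇒∣m*n β p∣P)))
    where
    p∣P = ∣m∣n⇒∣m+n (∣m⇒∣m*n k₂ p∣u₁) (∣m⇒∣m*n k₁ p∣u₂)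
    p∣Q = ∣m∣n⇒∣m-n (∣m⇒∣m*n k₂ p∣u₂) (∣m⇒∣m*n k₁ p∣u₁)

  2det : (L M : Fin (suc p)) → ℤ
  2det L M = + 2 ℤ.* det (line L) (line M)

  opaque

    D : (L M : Fin (suc p)) → Quaternion
    D L M = dyad (line L) (line M)

    D-*-D : ∀ L M N K → D L M *ᴴ D N K H.≈ 2det M N • D L K
    D-*-D L M N K = dyad-*-dyad (line L) (line M) (line N) (line K)

    D-antisym : ∀ L M → D L M H.- D M L H.≈ 2det M L • 1ᴴ
    D-antisym L M = dyad-antisym (line L) (line M)

    -- The matrix of `x` has determinant `norm x`, so modulo `p` it sends the vector of some line
    -- `L` to zero, and `*-dyad` applies.
    ∣norm⇒kernel : ∀ x → + p ∣ norm x → ∃[ L ] (∀ M → x *ᴴ D L M H.≈ 0ᴴ)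
    ∣norm⇒kernel x@(quaternion a b c d) p∣N =
      let L , p∣₁ , p∣₂ = kernel p-prime
              (a ℤ.+ (c ℤ.* α ℤ.- d ℤ.* β)) (c ℤ.* β ℤ.+ d ℤ.* α ℤ.- b)
              (c ℤ.* β ℤ.+ d ℤ.* α ℤ.+ b)   (a ℤ.- (c ℤ.* α ℤ.- d ℤ.* β))
            (≡0[mod]⇒∣ (≡-trans (det-matrix a b c d) (∣⇒≡0[mod] p∣N)))
      in L , λ M → H.trans (*-dyad x (line L) (line M)) (∣⇒dyad≈0 (line M) p∣₁ p∣₂)
      where open IsEquivalence (≡[mod]-isEquivalence {p}) using () renaming (trans to ≡-trans)

  2det-cancel : ∀ {L M x} → L ≢ M → 2det L M • x H.≈ 0ᴴ → x H.≈ 0ᴴ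
  2det-cancel {L} {M} L≢M = •-cancel-unit (2det L M) (∤⇒coprime p-prime
    ([ p∤2 , L≢M ∘ ∣det-line⇒≡ p-prime L M ]′ ∘ ∣*⇒∣⊎∣ p-prime (+ 2) (det (line L) (line M))))

  -- The image line of the right factor is the kernel line of the left one.
  D-self : ∀ L M N → D L M *ᴴ D M N H.≈ 0ᴴ
  D-self L M N = begin
    D L M *ᴴ D M N   ≈⟨ D-*-D L M M N ⟩
    2det M M • D L N ≈⟨ •-cong (≡⇒≡[mod] (2det≡0 (line M))) H.refl ⟩
    0ℤ • D L N       ≈⟨ 0• (D L N) ⟩
    0ᴴ               ∎
    where
    zero-det : ∀ a b → + 2 ℤ.* (a ℤ.* b ℤ.- b ℤ.* a) ≡ 0ℤ
    zero-det = solve-∀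
    2det≡0 : ∀ u → + 2 ℤ.* det u u ≡ 0ℤ
    2det≡0 (a , b) = zero-det a b
    0• : ∀ x → 0ℤ • x H.≈ 0ᴴ
    0• x = components (≡⇒≡[mod] refl) (≡⇒≡[mod] refl) (≡⇒≡[mod] refl) (≡⇒≡[mod] refl)

  -- Right multiplication by `D O N` with `O ≢ M` turns `D L M` into a unit multiple of `D L N`; so
  -- only the image line decides whether `x` annihilates a dyad.
  *D≈0⇒*D≈0 : ∀ x {L M} N → x *ᴴ D L M H.≈ 0ᴴ → x *ᴴ D L N H.≈ 0ᴴ
  *D≈0⇒*D≈0 x {L} {M} N xD≈0 = 2det-cancel (other-≢ M ∘ sym) (begin
    2det M O • (x *ᴴ D L N)   ≈⟨ *-•-comm (2det M O) x (D L N) ⟨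
    x *ᴴ (2det M O • D L N)   ≈⟨ H.*-congˡ {x = x} (D-*-D L M O N) ⟨
    x *ᴴ (D L M *ᴴ D O N)     ≈⟨ H.*-assoc x (D L M) (D O N) ⟨
    x *ᴴ D L M *ᴴ D O N       ≈⟨ H.*-congʳ xD≈0 ⟩
    0ᴴ *ᴴ D O N               ≈⟨ H.zeroˡ (D O N) ⟩
    0ᴴ                        ∎)
    where O = other M

  D*≈0⇒D*≈0 : ∀ x {L M} N → D M L *ᴴ x H.≈ 0ᴴ → D N L *ᴴ x H.≈ 0ᴴ
  D*≈0⇒D*≈0 x {L} {M} N Dx≈0 = 2det-cancel (other-≢ M) (begin
    2det O M • (D N L *ᴴ x)   ≈⟨ •-*-assoc (2det O M) (D N L) x ⟨
    (2det O M • D N L) *ᴴ x   ≈⟨ H.*-congʳ (D-*-D N O M L) ⟨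
    D N O *ᴴ D M L *ᴴ x       ≈⟨ H.*-assoc (D N O) (D M L) x ⟩
    D N O *ᴴ (D M L *ᴴ x)     ≈⟨ H.*-congˡ {x = D N O} Dx≈0 ⟩
    D N O *ᴴ 0ᴴ               ≈⟨ H.zeroʳ (D N O) ⟩
    0ᴴ                        ∎)
    where O = other M

  -- If `L` and `M` differed, `x` would annihilate `D L M` and `D M L`, hence their difference, a
  -- unit scalar.
  kernel-unique : ∀ x {L M K K′} → x H.≉ 0ᴴ →
                  x *ᴴ D L K H.≈ 0ᴴ → x *ᴴ D M K′ H.≈ 0ᴴ → L ≡ M
  kernel-unique x {L} {M} x≉0 xDL≈0 xDM≈0 = decidable-stable (L ≟ M) λ L≢M →
    x≉0 (2det-cancel (L≢M ∘ sym) (begin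
      2det M L • x                 ≈⟨ •-congˡ (2det M L) (H.*-identityʳ x) ⟨
      2det M L • (x *ᴴ 1ᴴ)         ≈⟨ *-•-comm (2det M L) x 1ᴴ ⟨
      x *ᴴ (2det M L • 1ᴴ)         ≈⟨ H.*-congˡ {x = x} (D-antisym L M) ⟨
      x *ᴴ (D L M H.- D M L)       ≈⟨ x[y-z]≈xy-xz (ℤ/ p [i,j,k]) x (D L M) (D M L) ⟩
      x *ᴴ D L M H.- x *ᴴ D M L    ≈⟨ H.+-cong (*D≈0⇒*D≈0 x M xDL≈0)
                                             (H.-‿cong (*D≈0⇒*D≈0 x L xDM≈0)) ⟩
      0ᴴ H.- 0ᴴ                    ≈⟨ H.-‿inverseʳ 0ᴴ ⟩
      0ᴴ                           ∎))

  cokernel-unique : ∀ x {L M K K′} → x H.≉ 0ᴴ →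
                    D K L *ᴴ x H.≈ 0ᴴ → D K′ M *ᴴ x H.≈ 0ᴴ → L ≡ M
  cokernel-unique x {L} {M} x≉0 DLx≈0 DMx≈0 = decidable-stable (L ≟ M) λ L≢M →
    x≉0 (2det-cancel (L≢M ∘ sym) (begin
      2det M L • x                 ≈⟨ •-congˡ (2det M L) (H.*-identityˡ x) ⟨
      2det M L • (1ᴴ *ᴴ x)         ≈⟨ •-*-assoc (2det M L) 1ᴴ x ⟨
      (2det M L • 1ᴴ) *ᴴ x         ≈⟨ H.*-congʳ (D-antisym L M) ⟨
      (D L M H.- D M L) *ᴴ x       ≈⟨ [y-z]x≈yx-zx (ℤ/ p [i,j,k]) x (D L M) (D M L) ⟩
      D L M *ᴴ x H.- D M L *ᴴ x    ≈⟨ H.+-cong (D*≈0⇒D*≈0 x L DMx≈0)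
                                             (H.-‿cong (D*≈0⇒D*≈0 x M DLx≈0)) ⟩
      0ᴴ H.- 0ᴴ                    ≈⟨ H.-‿inverseʳ 0ᴴ ⟩
      0ᴴ                           ∎))

  -- If `D L M` vanished, so would a second dyad with another image line, and `1` would have two
  -- kernel lines.
  D≉0 : ∀ L M → D L M H.≉ 0ᴴ
  D≉0 L M D≈0 = other-≢ L (kernel-unique 1ᴴ 1≉0 (1*≈0 DO≈0) (1*≈0 D≈0))
    where
    O = other L
    1≉0 : 1ᴴ H.≉ 0ᴴ
    1≉0 (components 1≡0 _ _ _) = ∤1 p-prime (≡0[mod]⇒∣ 1≡0)
    1*≈0 : ∀ {x} → x H.≈ 0ᴴ → 1ᴴ *ᴴ x H.≈ 0ᴴ
    1*≈0 {x} = H.trans (H.*-identityˡ x)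
    DO≈0 : D O M H.≈ 0ᴴ
    DO≈0 = 2det-cancel (other-≢ L) (begin
      2det O L • D O M   ≈⟨ D-*-D O O L M ⟨
      D O O *ᴴ D L M     ≈⟨ H.*-congˡ {x = D O O} D≈0 ⟩
      D O O *ᴴ 0ᴴ        ≈⟨ H.zeroʳ (D O O) ⟩
      0ᴴ                 ∎)

  -- `D zero L` annihilates the left side, hence also `D M K`; but so does `D zero M`, and
  -- `cokernel-unique` applies.
  •D-injectiveˡ : ∀ {c d L M K} → ¬ + p ∣ d → c • D L K H.≈ d • D M K → L ≡ M
  •D-injectiveˡ {c} {d} {L} {M} {K} p∤d cD≈dD = cokernel-unique (D M K) (D≉0 M K)
    (•-cancel-unit d (∤⇒coprime p-prime p∤d) (begin
      d • (D zero L *ᴴ D M K)   ≈⟨ *-•-comm d (D zero L) (D M K) ⟨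
      D zero L *ᴴ (d • D M K)   ≈⟨ H.*-congˡ {x = D zero L} cD≈dD ⟨
      D zero L *ᴴ (c • D L K)   ≈⟨ *-•-comm c (D zero L) (D L K) ⟩
      c • (D zero L *ᴴ D L K)   ≈⟨ •-congˡ c (D-self zero L K) ⟩
      c • 0ᴴ                    ≈⟨ •-zeroʳ c ⟩
      0ᴴ                        ∎))
    (D-self zero M K)

  -- The count needs two multiples of a dyad that differ modulo `p`. Both values are units because
  -- `p` is odd.
  scalar : Bool → ℤ
  scalar b = if b then + 2 else 1ℤ

  p∤scalar : ∀ b → ¬ + p ∣ scalar b
  p∤scalar false = ∤1 p-prime
  p∤scalar true  = p∤2

  scalar•D≉0 : ∀ b L M → scalar b • D L M H.≉ 0ᴴ
  scalar•D≉0 b L M cD≈0 = D≉0 L M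
    (•-cancel-unit (scalar b) (∤⇒coprime p-prime (p∤scalar b)) cD≈0)

  2•≈1•⇒≈0 : ∀ {x} → + 2 • x H.≈ 1ℤ • x → x H.≈ 0ᴴ
  2•≈1•⇒≈0 (components e₁ e₂ e₃ e₄) = components (half e₁) (half e₂) (half e₃) (half e₄)
    where
    2a-a≡a : ∀ a → + 2 ℤ.* a ℤ.- 1ℤ ℤ.* a ≡ a
    2a-a≡a = solve-∀
    half : ∀ {a} → + 2 ℤ.* a ≡ 1ℤ ℤ.* a [mod p ] → a ≡ 0ℤ [mod p ]
    half {a} = ∣⇒≡0[mod] ∘ subst (+ p ∣_) (2a-a≡a a) ∘ n∣a-b

  scalar-injective : ∀ b c {x} → x H.≉ 0ᴴ → scalar b • x H.≈ scalar c • x → b ≡ c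
  scalar-injective false false _   _  = refl
  scalar-injective true  true  _   _  = refl
  scalar-injective false true  x≉0 eq = contradiction (2•≈1•⇒≈0 (H.sym eq)) x≉0
  scalar-injective true  false x≉0 eq = contradiction (2•≈1•⇒≈0 eq) x≉0

  scalar•D-injective : ∀ {b c L M K} →
                       scalar b • D L K H.≈ scalar c • D M K → b ≡ c × L ≡ M
  scalar•D-injective {b} {c} {L} {M} {K} eq =
      scalar-injective b c (D≉0 L K)
        (subst (λ N → scalar b • D L K H.≈ scalar c • D N K) (sym L≡M) eq)
    , L≡M
    where
    L≡M : L ≡ M
    L≡M = •D-injectiveˡ {scalar b} {scalar c} {L} {M} {K} (p∤scalar c) eq

  kernelLine : ∀ {x} → x H.≉ 0ᴴ → ∃[ L ] (∀ M K → x *ᴴ D M K H.≈ 0ᴴ → M ≡ L)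
  kernelLine {x} x≉0 with any? (λ L → any? (λ K → (x *ᴴ D L K) ≈ᴴ? 0ᴴ [mod p ]))
  ... | yes (L , K , xD≈0) = L , λ M K′ xD′≈0 → kernel-unique x x≉0 xD′≈0 xD≈0
  -- An `x` that annihilates no dyad satisfies the condition vacuously; `zero` is a mere default.
  ... | no none            = zero , λ M K xD≈0 → contradiction (M , K , xD≈0) none

  cokernelLine : ∀ {x} → x H.≉ 0ᴴ → ∃[ L ] (∀ K M → D K M *ᴴ x H.≈ 0ᴴ → M ≡ L)
  cokernelLine {x} x≉0 with any? (λ L → any? (λ K → (D K L *ᴴ x) ≈ᴴ? 0ᴴ [mod p ]))
  ... | yes (L , K , Dx≈0) = L , λ K′ M Dx′≈0 → cokernel-unique x x≉0 Dx′≈0 Dx≈0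
  ... | no none            = zero , λ K M Dx≈0 → contradiction (M , K , Dx≈0) none

-- The counting argument.

-- If every `K` were attained, choosing preimages would inject `Fin n` into `Fin m`.
missed-value : ∀ {m n} → m ℕ.< n → (f : Fin m → Fin n) → ∃[ K ] (∀ i → f i ≢ K)
missed-value m<n f =
  let K , K∉f = ¬∀⟶∃¬ _ (λ K → ∃[ i ] f i ≡ K) (λ K → any? (λ i → f i ≟ K)) not-surjective
  in K , λ i fi≡K → K∉f (i , fi≡K)
  where
  not-surjective : ¬ (∀ K → ∃[ i ] f i ≡ K)
  not-surjective f⁻¹ = ℕ.<⇒≱ m<n (injective⇒≤ {f = proj₁ ∘ f⁻¹} λ {K} {L} eq →
    trans (sym (proj₂ (f⁻¹ K))) (trans (cong f eq) (proj₂ (f⁻¹ L))))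

-- Is false L K i and Is true L K i say that the i-th element of S is D L K,
-- respectively 2 D L K.

module Counting {m n : ℕ} (f g : Fin m → Fin n) (Is : Bool → Fin n → Fin n → Fin m → Set)
  (present : ∀ b {L K} → (∀ i → f i ≢ L) → (∀ i → g i ≢ K) → ∃[ i ] Is b L K i)
  (f-Is : ∀ {b L K i} → Is b L K i → f i ≡ K)
  (Is-injective : ∀ {b c L M K i} → Is b L K i → Is c M K i → b ≡ c × L ≡ M)
  where

  n≤m : n ≤ m
  n≤m = ℕ.≮⇒≥ λ m<n →
    let K , K∉g = missed-value m<n g
        L₀ , L₀∉f = missed-value m<n f
    in ℕ.<⇒≱ m<n (injective⇒≤ (assign-injective K K∉g L₀ L₀∉f))
    where
    module _ K (K∉g : ∀ i → g i ≢ K) L₀ (L₀∉f : ∀ i → f i ≢ L₀) where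

      data Assigned (L : Fin n) (i : Fin m) : Set where
        pivot   : L ≡ K → Is true L₀ K i → Assigned L i
        hit     : L ≢ K → f i ≡ L → Assigned L i
        missing : Is false L K i → Assigned L i

      assign : ∀ L → ∃[ i ] Assigned L i
      assign L with L ≟ K
      ... | yes L≡K = let i , is = present true L₀∉f K∉g in i , pivot L≡K is
      ... | no  L≢K with any? (λ i → f i ≟ L)
      ...   | yes (i , fi≡L) = i , hit L≢K fi≡L
      ...   | no  L∉f        = let i , is = present false (λ i fi≡L → L∉f (i , fi≡L)) K∉g
                                   in i , missing is

      -- By `f-Is`, `f` takes the value `K` in the cases `pivot` and `missing`, but not in the case
      -- `hit`. The scalar separates `pivot` from `missing`.
      unique : ∀ {L M i} → Assigned L i → Assigned M i → L ≡ M
      unique (pivot L≡K _)  (pivot M≡K _)  = trans L≡K (sym M≡K)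
      unique (pivot _ is)   (hit M≢K fi≡M) = contradiction (trans (sym fi≡M) (f-Is is)) M≢K
      unique (pivot _ is)   (missing is′)  = case proj₁ (Is-injective is is′) of λ ()
      unique (hit L≢K fi≡L) (pivot _ is)   = contradiction (trans (sym fi≡L) (f-Is is)) L≢K
      unique (hit _ fi≡L)   (hit _ fi≡M)   = trans (sym fi≡L) fi≡M
      unique (hit L≢K fi≡L) (missing is)   = contradiction (trans (sym fi≡L) (f-Is is)) L≢K
      unique (missing is)   (pivot _ is′)  = case proj₁ (Is-injective is is′) of λ ()
      unique (missing is)   (hit M≢K fi≡M) = contradiction (trans (sym fi≡M) (f-Is is)) M≢K
      unique (missing is)   (missing is′)  = proj₂ (Is-injective is is′)

      assign-injective : ∀ {L M} → proj₁ (assign L) ≡ proj₁ (assign M) → L ≡ M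
      assign-injective {L} {M} eq =
        unique (subst (Assigned L) eq (proj₂ (assign L))) (proj₂ (assign M))

-- Domination in the graph modulo `p ^ suc r`.

module Domination {p-2} (p-prime : Prime (2 ℕ.+ p-2)) (p∤2 : ¬ + (2 ℕ.+ p-2) ∣ + 2)
  (α β : ℤ) (p∣α²+β²+1 : + (2 ℕ.+ p-2) ∣ α ℤ.* α ℤ.+ β ℤ.* β ℤ.+ 1ℤ) (r : ℕ)
  where

  open Dyads p-prime p∤2 α β p∣α²+β²+1

  private
    p = 2 ℕ.+ p-2
    n = p ^ suc r
    q = p ^ r
    R = ℤ/ n [i,j,k]
    module H = Ring (ℤ/ p [i,j,k])
    module R = Ring R
    instance
      q≢0 : NonZero q
      q≢0 = ℕ.m^n≢0 p r

  open ≈-Reasoning R.setoid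
  open Graph (Γ̄ R) using (vertices; Vertex; _~_)
  open Membership vertices using (_∈_)

  -- With `q = p ^ r`, the multiple `q • x` modulo `p ^ suc r` retains exactly the residue of `x`
  -- modulo `p`.
  q•-lift : ∀ {x} → x H.≈ 0ᴴ → + q • x R.≈ 0ᴴ
  q•-lift {x} x≈0 = R.trans
    (subst (+ q • x ≈ᴴ + q • 0ᴴ [mod_]) (ℕ.*-comm q p) (•-lift q x≈0)) (•-zeroʳ (+ q))

  q•-lower : ∀ {x y} → + q • x R.≈ + q • y → x H.≈ y
  q•-lower {x} {y} = •-lower q ∘ subst (+ q • x ≈ᴴ + q • y [mod_]) (ℕ.*-comm p q)

  reduce : ∀ {x y} → x R.≈ y → x H.≈ y
  reduce = ≈ᴴ-reduce (ℕ.m∣m*n q)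

  q•D≉0 : ∀ L M → + q • D L M R.≉ 0ᴴ
  q•D≉0 L M qD≈0 = D≉0 L M (q•-lower (R.trans qD≈0 (R.sym (•-zeroʳ (+ q)))))

  -- The image line of `D M M` is the kernel line of `D L M`; their product vanishes modulo `p`, and
  -- the factor `q` lifts this to `p ^ suc r`.
  •D-zeroDivisor : ∀ c L M → IsZeroDivisor R (c • D L M)
  •D-zeroDivisor c L M = inj₁ (+ q • D M M , q•D≉0 M M , (begin
    (c • D L M) *ᴴ (+ q • D M M)  ≈⟨ •-*-assoc c (D L M) (+ q • D M M) ⟩
    c • (D L M *ᴴ (+ q • D M M))  ≈⟨ •-congˡ c (*-•-comm (+ q) (D L M) (D M M)) ⟩
    c • + q • (D L M *ᴴ D M M)    ≈⟨ •-congˡ c (q•-lift (D-self L M M)) ⟩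
    c • 0ᴴ                        ≈⟨ •-zeroʳ c ⟩
    0ᴴ                            ∎))

  dominator : Fin (suc p) → Vertex
  dominator L = + q • D L zero , q•D≉0 L zero , •D-zeroDivisor (+ q) L zero

  dominators : List Vertex
  dominators = tabulate dominator

  dominators-dominating : IsDominatingSet (Γ̄ R) dominators
  dominators-dominating =
      Unique.tabulate⁺ vertices {f = dominator} (λ {L} {M} eq →
        •D-injectiveˡ {1ℤ} {1ℤ} {L} {M} (∤1 p-prime)
        (H.trans (•-identity (D L zero))
          (H.trans (q•-lower eq) (H.sym (•-identity (D M zero))))))
    , λ x@(a , a≉0 , a-zd) x∉S →
        let L , aD≈0 = ∣norm⇒kernel a (zeroDivisor⇒∣norm p-prime (suc r) a-zd)
            y∈S = ∈-tabulate⁺ vertices {f = dominator} L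
        in dominator L , y∈S
         , (λ a≈y → x∉S (Any.map (λ {z} → R.trans {k = proj₁ z} a≈y) y∈S))
         , inj₁ (R.trans (*-•-comm (+ q) a (D L zero)) (q•-lift (aD≈0 zero)))

  module _ (S : List Vertex) (S-dominating : IsDominatingSet (Γ̄ R) S) where

    private
      element : Fin (length S) → Quaternion
      element i = proj₁ (lookup S i)

      open module Part i = PrimitivePart
        (primitivePart p-prime (suc r) {element i} (proj₁ (proj₂ (lookup S i))))

      f g : Fin (length S) → Fin (suc p)
      f i = proj₁ (kernelLine (part≉0 i))
      g i = proj₁ (cokernelLine (part≉0 i))

      Is : Bool → Fin (suc p) → Fin (suc p) → Fin (length S) → Set
      Is b L K i = scalar b • D L K R.≈ element i

      unit-cancel : ∀ b {x} → scalar b • x R.≈ 0ᴴ → x R.≈ 0ᴴ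
      unit-cancel b = •-cancel-unit (scalar b) (∤⇒coprime-^ p-prime (suc r) (p∤scalar b))

      -- The unit scalar cancels, and the primitive part inherits the annihilation modulo `p`, where
      -- its kernel line is unique.
      f-killed : ∀ b {L K} i → element i *ᴴ (scalar b • D L K) R.≈ 0ᴴ → f i ≡ L
      f-killed b {L} {K} i yD≈0 = sym (proj₂ (kernelLine (part≉0 i)) L K
        (annihilatesʳ i (D L K) (unit-cancel b
          (R.trans (R.sym (*-•-comm (scalar b) (element i) (D L K))) yD≈0))))

      g-killed : ∀ b {L K} i → (scalar b • D L K) *ᴴ element i R.≈ 0ᴴ → g i ≡ K
      g-killed b {L} {K} i Dy≈0 = sym (proj₂ (cokernelLine (part≉0 i)) L K
        (annihilatesˡ i (D L K) (unit-cancel b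
          (R.trans (R.sym (•-*-assoc (scalar b) (D L K) (element i))) Dy≈0))))

      -- Were the vertex outside `S`, it would have a neighbour there, at position `i` say, and the
      -- vanishing product would make `L = f i` or `K = g i`.
      present : ∀ b {L K} → (∀ i → f i ≢ L) → (∀ i → g i ≢ K) → ∃[ i ] Is b L K i
      present b {L} {K} L∉f K∉g = fromDec (Any.any? (λ y → x≈? (proj₁ y)) S)
        where
        x : Vertex
        x = scalar b • D L K
          , (λ x≈0 → scalar•D≉0 b L K (reduce x≈0))
          , •D-zeroDivisor (scalar b) L K
        x≈? : ∀ y → Dec (scalar b • D L K R.≈ y)
        x≈? y = (scalar b • D L K) ≈ᴴ? y [mod n ]
        not-adjacent : ∀ {y} → y ∈ S → ¬ (x ~ y)
        not-adjacent {y} y∈S (_ , xy≈0⊎yx≈0) = [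
            (λ xy≈0 → K∉g i (g-killed b i (R.trans (R.*-congˡ {x = proj₁ x} (R.sym y≈)) xy≈0)))
          , (λ yx≈0 → L∉f i (f-killed b i (R.trans (R.*-congʳ (R.sym y≈)) yx≈0))) ]′ xy≈0⊎yx≈0
          where
          i = Any.index y∈S
          y≈ : proj₁ y R.≈ element i
          y≈ = lookup-index y∈S
        fromDec : Dec (x ∈ S) → ∃[ i ] Is b L K i
        fromDec (yes x∈S) = Any.index x∈S , lookup-index x∈S
        fromDec (no x∉S)  = let y , y∈S , x~y = proj₂ S-dominating x x∉S
                            in contradiction x~y (not-adjacent {y} y∈S)

      -- Being nonzero modulo `p`, the element is its own primitive part. Modulo `p` it annihilates
      -- `D K K`, so its kernel line is `K`.
      f-Is : ∀ {b L K i} → Is b L K i → f i ≡ K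
      f-Is {b} {L} {K} {i} x≈y = sym (proj₂ (kernelLine (part≉0 i)) K K
        (subst (λ z → z *ᴴ D K K H.≈ 0ᴴ)
          (sym (part-of-unit i (λ y≈0 → scalar•D≉0 b L K (H.trans (reduce x≈y) y≈0))))
          (H.trans (H.*-congʳ (H.sym (reduce x≈y)))
            (H.trans (•-*-assoc (scalar b) (D L K) (D K K))
              (H.trans (•-congˡ (scalar b) (D-self L K K)) (•-zeroʳ (scalar b)))))))

    suc-p≤length : suc p ≤ length S
    suc-p≤length = Counting.n≤m f g Is present (λ {b} → f-Is {b})
      (λ {b} {c} x≈y x′≈y → scalar•D-injective {b} {c} (reduce (R.trans x≈y (R.sym x′≈y))))

  dominationNumber : IsDominationNumber (Γ̄ R) (suc p)
  dominationNumber =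
    (dominators , dominators-dominating , length-tabulate dominator) , suc-p≤length

open import Data.Nat using (_+_)

theorem2p4 : ∀ (p s : ℕ) → Prime p → 2 ∤ p → 1 ≤ s →
    IsDominationNumber (Γ̄ (ℤ/ (p ^ s) [i,j,k])) (p + 1)
-- Excluding `0` and `1` brings `p` into the form `2 + p-2`, for which every line has an `other`.
theorem2p4 0 _ p-prime = contradiction p-prime λ ()
theorem2p4 1 _ p-prime = contradiction p-prime λ ()
theorem2p4 p@(suc (suc _)) (suc r) p-prime 2∤p (s≤s _) =
  let h , p≡1+h+h = odd⇒≡1+h+h 2∤p
      α , β , p∣α²+β²+1 = sum-of-squares≡-1 p-prime h p≡1+h+h
  in subst (IsDominationNumber (Γ̄ (ℤ/ (p ^ suc r) [i,j,k]))) (ℕ.+-comm 1 p)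
       (Domination.dominationNumber p-prime p∤2 α β p∣α²+β²+1 r)
  where
  p∤2 : ¬ + p ∣ + 2
  p∤2 p∣2 with irreducible[2] (∣⇒∣ᵤ p∣2)
  -- The alternative `p ≡ 1` is excluded by the form of `p`, and `p ≡ 2` by oddness.
  ... | inj₂ p≡2 = 2∤p (ℕ.∣-reflexive (sym p≡2))
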